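{- There is a linear-time algorithm that solves the Strong Geodetic problem (given a graph $G$ and a positive integer $k$, decide whether $G$ has a strong geodetic set $S$ with $|S|\le k$) for block graphs $G$.
   Context: All graphs are finite, simple, undirected and connected. A block graph is a graph in which every biconnected component is a complete subgraph. A shortest path assignment $I(S)$ of a vertex set $S\subseteq V(G)$ consists of exactly one chosen shortest path of $G$ between $u$ and $v$ for each unordered pair of distinct vertices $u,v\in S$. The set $S$ is a strong geodetic set of $G$ if there is a shortest path assignment $I(S)$ such that every vertex of $V(G)\setminus S$ lies on some path of $I(S)$ (for $|S|\ge 2$ this is the same as $\bigcup_{P\in I(S)}V(P)=V(G)$). Linear time means time $\mathcal{O}(|V(G)|+|E(G)|)$. -}

module Defs where

open import Data.Bool.Base using (if_then_else_; _∧_)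
open import Data.Fin.Base using (Fin; toℕ; _<_)
open import Data.Fin.Properties using (_<?_)
open import Data.Fin.Subset using (Subset; _∈_; _∉_; _⊆_; Nonempty; _-_; ∣_∣)
open import Data.List.Base
  using (List; []; _∷_; length; map; concat; filter; allFin; cartesianProduct)
import Data.List.Membership.Propositional as List
open import Data.List.Relation.Unary.Unique.Propositional using (Unique)
open import Data.Nat.Base as ℕ using (ℕ; zero; suc; _+_; _*_; _∸_; _≤_; _^_; NonZero)
open import Data.Nat.Properties using (_≟_)
open import Data.Product.Base using (Σ-syntax; ∃-syntax; _×_; _,_)
open import Data.Sum.Base using (_⊎_)
open import Function.Bundles using (_⇔_)
open import Level using (0ℓ)
open import Relation.Binary.Core using (Rel)
open import Relation.Binary.Construct.Closure.ReflexiveTransitive using (Star; ε; _◅_)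
open import Relation.Binary.Definitions using (Decidable; Symmetric; Irreflexive)
open import Relation.Binary.PropositionalEquality.Core using (_≡_; _≢_)
open import Relation.Nullary using (¬_; does)
open import Relation.Nullary.Decidable using (_×-dec_)

------------------------------------------------------------------------
-- Finite simple graphs

record Graph : Set₁ where
  infix 4 _~_ _~?_
  field
    order    : ℕ
    nonempty : NonZero order
    _~_      : Rel (Fin order) 0ℓ
    _~?_     : Decidable _~_
    sym      : Symmetric _~_
    irrefl   : Irreflexive _≡_ _~_

  Vertex : Set
  Vertex = Fin order

  edges : List (Vertex × Vertex)
  edges = filter (λ { (u , v) → (u <? v) ×-dec (u ~? v) })
                 (cartesianProduct (allFin order) (allFin order))

  size : ℕ
  size = length edges

  Walk : Vertex → Vertex → Set
  Walk = Star _~_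

  vertices : ∀ {u v} → Walk u v → List Vertex
  vertices {u} ε       = u ∷ []
  vertices {u} (_ ◅ w) = u ∷ vertices w

  walkLength : ∀ {u v} → Walk u v → ℕ
  walkLength ε       = 0
  walkLength (_ ◅ w) = suc (walkLength w)

  record Path (u v : Vertex) : Set where
    field
      walk   : Walk u v
      simple : Unique (vertices walk)

  open Path public

  pathLength : ∀ {u v} → Path u v → ℕ
  pathLength p = walkLength (walk p)

  record ShortestPath (u v : Vertex) : Set where
    field
      path     : Path u v
      shortest : (q : Path u v) → pathLength path ≤ pathLength q

  open ShortestPath public

  _liesOn_ : ∀ {u v} → Vertex → ShortestPath u v → Set
  x liesOn p = x List.∈ vertices (walk (path p))

  Connected : Set
  Connected = ∀ u v → Walk u v

  ----------------------------------------------------------------------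
  -- Block graphs

  -- Adjacency in the subgraph induced by B.
  Induced : Subset order → Rel Vertex 0ℓ
  Induced B u v = u ∈ B × v ∈ B × u ~ v

  ConnectedOn : Subset order → Set
  ConnectedOn B = ∀ {u v} → u ∈ B → v ∈ B → Star (Induced B) u v

  -- Connected and without cut vertices; a single vertex and a single edge
  -- qualify, so that a bridge is a biconnected component.
  Biconnected : Subset order → Set
  Biconnected B = Nonempty B × ConnectedOn B × (∀ {x} → x ∈ B → ConnectedOn (B - x))

  -- Adding edges between its vertices keeps a subgraph biconnected, so the
  -- maximal biconnected subgraphs are induced and given by their vertex sets.
  BiconnectedComponent : Subset order → Set
  BiconnectedComponent B =
    Biconnected B × (∀ C → Biconnected C → B ⊆ C → C ⊆ B)

  Complete : Subset order → Set
  Complete B = ∀ {u v} → u ∈ B → v ∈ B → u ≢ v → u ~ v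

  IsBlockGraph : Set
  IsBlockGraph = ∀ B → BiconnectedComponent B → Complete B

  ----------------------------------------------------------------------
  -- Strong geodetic sets

  -- An unordered pair of distinct vertices is represented by u < v.
  ShortestPathAssignment : Subset order → Set
  ShortestPathAssignment S = ∀ {u v} → u ∈ S → v ∈ S → u < v → ShortestPath u v

  IsStrongGeodetic : Subset order → Set
  IsStrongGeodetic S =
    Σ[ I ∈ ShortestPathAssignment S ]
      (∀ x → x ∉ S →
        ∃[ u ] ∃[ v ] Σ[ u∈S ∈ u ∈ S ] Σ[ v∈S ∈ v ∈ S ] Σ[ u<v ∈ u < v ]
          x liesOn I u∈S v∈S u<v)

  StrongGeodetic : ℕ → Set
  StrongGeodetic k = ∃[ S ] (IsStrongGeodetic S × ∣ S ∣ ≤ k)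

------------------------------------------------------------------------
-- A word RAM with structured control
--
-- Memory consists of arrays of natural numbers. A program mentions only
-- finitely many array names, all of them literals, so with K names cell i of
-- array a can be taken to be cell K * i + a of a flat memory, at constant
-- overhead. Cell 0 of an array serves as a register.

Memory : Set
Memory = ℕ → ℕ → ℕ

infixl 6 _⊕_ _⊖_
infix  7 _[_]

data Expr : Set where
  lit     : ℕ → Expr
  _[_]    : ℕ → Expr → Expr
  _⊕_ _⊖_ : Expr → Expr → Expr

infix  3 _[_]≔_
infixr 2 _⨾_

data Program : Set where
  skip    : Program
  _[_]≔_  : ℕ → Expr → Expr → Program
  _⨾_     : Program → Program → Program
  cond    : Expr → Program → Program → Program
  while   : Expr → Program → Program

⟦_⟧ : Expr → Memory → ℕ
⟦ lit n ⟧   μ = n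
⟦ a [ e ] ⟧ μ = μ a (⟦ e ⟧ μ)
⟦ e ⊕ f ⟧   μ = ⟦ e ⟧ μ + ⟦ f ⟧ μ
⟦ e ⊖ f ⟧   μ = ⟦ e ⟧ μ ∸ ⟦ f ⟧ μ

-- One unit per literal, memory access and arithmetic operation.
cost : Expr → ℕ
cost (lit _)   = 1
cost (_ [ e ]) = 1 + cost e
cost (e ⊕ f)   = 1 + cost e + cost f
cost (e ⊖ f)   = 1 + cost e + cost f

_[_,_↦_] : Memory → ℕ → ℕ → ℕ → Memory
(μ [ a , i ↦ x ]) b j = if does (a ≟ b) ∧ does (i ≟ j) then x else μ b j

-- W ⊢ ⟨ P , μ ⟩⇓ ν ∣ t : started in memory μ, P halts in memory ν after t
-- units of time, and every address and value it writes is at most W.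
-- There is no rule for a write exceeding W, so such a run does not halt.
-- A condition holds if its value is nonzero.
infix 1 _⊢⟨_,_⟩⇓_∣_

data _⊢⟨_,_⟩⇓_∣_ (W : ℕ) : Program → Memory → Memory → ℕ → Set where

  skip : ∀ {μ} → W ⊢⟨ skip , μ ⟩⇓ μ ∣ 1

  assign : ∀ {μ a e f} → ⟦ e ⟧ μ ≤ W → ⟦ f ⟧ μ ≤ W →
    W ⊢⟨ a [ e ]≔ f , μ ⟩⇓ μ [ a , ⟦ e ⟧ μ ↦ ⟦ f ⟧ μ ] ∣ 1 + cost e + cost f

  seq : ∀ {P Q μ ν ξ s t} →
    W ⊢⟨ P , μ ⟩⇓ ν ∣ s → W ⊢⟨ Q , ν ⟩⇓ ξ ∣ t →
    W ⊢⟨ P ⨾ Q , μ ⟩⇓ ξ ∣ s + t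

  cond-true : ∀ {e P Q μ ν t} → ⟦ e ⟧ μ ≢ 0 →
    W ⊢⟨ P , μ ⟩⇓ ν ∣ t →
    W ⊢⟨ cond e P Q , μ ⟩⇓ ν ∣ 1 + cost e + t

  cond-false : ∀ {e P Q μ ν t} → ⟦ e ⟧ μ ≡ 0 →
    W ⊢⟨ Q , μ ⟩⇓ ν ∣ t →
    W ⊢⟨ cond e P Q , μ ⟩⇓ ν ∣ 1 + cost e + t

  while-true : ∀ {e P μ ν ξ s t} → ⟦ e ⟧ μ ≢ 0 →
    W ⊢⟨ P , μ ⟩⇓ ν ∣ s → W ⊢⟨ while e P , ν ⟩⇓ ξ ∣ t →
    W ⊢⟨ while e P , μ ⟩⇓ ξ ∣ 1 + cost e + s + t

  while-false : ∀ {e P μ} → ⟦ e ⟧ μ ≡ 0 →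
    W ⊢⟨ while e P , μ ⟩⇓ μ ∣ 1 + cost e

------------------------------------------------------------------------
-- Input and output

-- The neighbours of a vertex may be listed in any order.
record AdjacencyLists (G : Graph) : Set where
  open Graph G
  field
    neighbours : Vertex → List Vertex
    correct    : ∀ {u v} → v List.∈ neighbours u ⇔ u ~ v
    distinct   : ∀ u → Unique (neighbours u)

prefixSums : ℕ → List ℕ → List ℕ
prefixSums s []       = s ∷ []
prefixSums s (x ∷ xs) = s ∷ prefixSums (s + x) xs

contents : List ℕ → ℕ → ℕ
contents []       _       = 0
contents (x ∷ xs) zero    = x
contents (x ∷ xs) (suc i) = contents xs i

-- Array 0 holds the number of vertices and k; array 2 is the concatenation of
-- the adjacency lists, in which the list of vertex v occupies the cells from
-- (array 1)[v] up to but excluding (array 1)[v+1].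
-- All other cells are zero.
input : (G : Graph) → AdjacencyLists G → ℕ → Memory
input G L k = λ where
    0 → contents (Graph.order G ∷ k ∷ [])
    1 → contents (prefixSums 0 (map length lists))
    2 → contents (map toℕ (concat lists))
    _ → contents []
  where
  lists : List (List (Graph.Vertex G))
  lists = map (AdjacencyLists.neighbours L) (allFin (Graph.order G))

Answers : Memory → Set → Set
Answers μ A = (A × μ 0 0 ≡ 1) ⊎ (¬ A × μ 0 0 ≡ 0)

-- P solves StrongGeodetic on the graphs of the class 𝒞, in time at most
-- c (|V| + |E|), with words of c log₂ (|V| + |E| + k) bits.
SolvesInLinearTime : (𝒞 : Graph → Set) → Program → ℕ → Set₁
SolvesInLinearTime 𝒞 P c =
  ∀ (G : Graph) (L : AdjacencyLists G) (k : ℕ) → 𝒞 G → 1 ≤ k →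
  let open Graph G in
  ∃[ μ ] ∃[ t ]
    ((order + size + k) ^ c ⊢⟨ P , input G L k ⟩⇓ μ ∣ t)
    × t ≤ c * (order + size)
    × Answers μ (StrongGeodetic k)

{-# OPTIONS --safe #-}

-- In a block graph the simplicial vertices form a smallest strong geodetic set. All rests on
-- one fact: two non-adjacent neighbours of v are separated by v, since a path between them
-- avoiding v closes up to a cycle through v, which is biconnected and hence spans a clique.
-- A simplicial vertex is never interior to a shortest path, so it is in every strong
-- geodetic set. If v is not simplicial, extend a simple path from v through one of its
-- neighbours: at a non-simplicial end one of two non-adjacent neighbours is off the path, so
-- the extension stops at a simplicial vertex. Thus there are simplicial vertices on two
-- sides of v, and any shortest path between them contains v.
--
-- By the same fact v is simplicial as soon as it has a neighbour u adjacent to all other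
-- neighbours of v. It suffices to compare the list of v once, with the marked list of the
-- first u at which v is met, so each list is traversed a bounded number of times.

module Submission where

open import Defs
open import Data.Bool.Base using (true; false; if_then_else_; T)
open import Data.Empty using (⊥; ⊥-elim)
open import Data.Fin.Base using (Fin; toℕ; fromℕ<; zero; suc)
import Data.Fin.Base as Fin
import Data.Fin.Properties as Fin
open import Data.Fin.Subset using (Subset; _∈_; _∉_; _⊆_; _-_; ∣_∣)
open import Data.Fin.Subset.Properties
  using (_∈?_; p⊂q⇒∣p∣<∣q∣; p⊆q⇒∣p∣≤∣q∣; ∣p∣≤n; p─q⊆p; x∈p∧x≢y⇒x∈p-y)
open import Data.List.Base as List using (List; []; _∷_; _++_; length; map; concat; allFin)
open import Data.List.Properties
  using (length-++; length-map; length-tabulate; map-tabulate; map-∘; map-cong)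
import Data.List.Membership.DecPropositional as DecMembership
import Data.List.Membership.Propositional as List
open import Data.List.Membership.Propositional.Properties
  using (∈-∃++; ∈-++⁻; ∈-++⁺ˡ; ∈-++⁺ʳ; ∈-allFin; ∈-concat⁻′; ∈-map⁺; ∈-map⁻; ∈-filter⁺; ∈-cartesianProduct⁺)
open import Data.List.Relation.Unary.All using ([]; _∷_; lookup)
import Data.List.Relation.Unary.All.Properties as All
import Data.List.Relation.Unary.AllPairs as AllPairs
open import Data.List.Relation.Unary.AllPairs using ([]; _∷_)
import Data.List.Relation.Unary.AllPairs.Properties as AllPairs
open import Data.List.Relation.Unary.Any using (here; there; index)
open import Data.List.Relation.Unary.Unique.Propositional using (Unique)
import Data.List.Relation.Unary.Unique.Propositional.Properties as Unique
open import Data.Nat.Base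
  using (ℕ; zero; suc; _+_; _*_; _∸_; _^_; _≤_; _<_; z≤n; s≤s; _≤ᵇ_; _≡ᵇ_; >-nonZero; >-nonZero⁻¹)
open import Data.Nat.Induction using (<-wellFounded)
open import Data.Nat.ListAction using (sum)
open import Data.Nat.Properties
open import Data.Nat.Tactic.RingSolver using (solve-∀)
open import Data.Product.Base using (Σ-syntax; ∃-syntax; _×_; _,_; swap)
open import Data.Sum.Base using (_⊎_; inj₁; inj₂)
open import Data.Vec.Base using (tabulate; _∷_; there)
open import Data.Vec.Properties using (lookup∘tabulate; []=⇒lookup; lookup⇒[]=)
open import Function.Base using (_∘_; id)
open import Function.Bundles using (Equivalence)
open import Induction.WellFounded using (Acc; acc)
open import Relation.Binary.Construct.Closure.ReflexiveTransitive
  using (Star; ε; _◅_; _◅◅_; reverse; gmap)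
open import Relation.Binary.Definitions using (tri<; tri≈; tri>)
open import Relation.Binary.PropositionalEquality
  using (_≡_; _≢_; refl; sym; trans; cong; cong₂; subst; subst₂; ≢-sym; module ≡-Reasoning)
open import Relation.Nullary using (¬_; Dec; yes; no; does; contradiction)
open import Relation.Nullary.Decidable using (map′; _×-dec_; decidable-stable; dec-true)
open import Relation.Unary using (Decidable)

-- Duplicate-free lists and decidable subsets

-- Pigeonhole: delete one occurrence of the head from `ys`. By uniqueness the tail avoids the head,
-- so it is still contained in what remains.
length-mono-Unique : ∀ {A : Set} {xs ys : List A} → Unique xs →
  (∀ {x} → x List.∈ xs → x List.∈ ys) → length xs ≤ length ys
length-mono-Unique {xs = []} _ _ = z≤n
length-mono-Unique {xs = x ∷ xs} (x≢ ∷ uniq) xs⊆ys with ∈-∃++ (xs⊆ys (here refl))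
... | as , bs , refl = begin
  suc (length xs)             ≤⟨ s≤s (length-mono-Unique uniq xs⊆as++bs) ⟩
  suc (length (as ++ bs))     ≡⟨ cong suc (length-++ as) ⟩
  suc (length as + length bs) ≡⟨ +-suc (length as) (length bs) ⟨
  length as + suc (length bs) ≡⟨ length-++ as ⟨
  length (as ++ x ∷ bs)       ∎
  where
  open ≤-Reasoning
  xs⊆as++bs : ∀ {y} → y List.∈ xs → y List.∈ as ++ bs
  xs⊆as++bs y∈ with ∈-++⁻ as (xs⊆ys (there y∈))
  ... | inj₁ y∈as         = ∈-++⁺ˡ y∈as
  ... | inj₂ (here refl)  = contradiction refl (lookup x≢ y∈)
  ... | inj₂ (there y∈bs) = ∈-++⁺ʳ as y∈bs

⟪_⟫ : ∀ {n} {P : Fin n → Set} → Decidable P → Subset n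
⟪ P? ⟫ = tabulate (does ∘ P?)

module _ {n} {P : Fin n → Set} (P? : Decidable P) where

  ∈⟪⟫⁺ : ∀ {x} → P x → x ∈ ⟪ P? ⟫
  ∈⟪⟫⁺ {x} px = lookup⇒[]= x _ (trans (lookup∘tabulate _ x) (dec-true (P? x) px))

  ∈⟪⟫⁻ : ∀ {x} → x ∈ ⟪ P? ⟫ → P x
  ∈⟪⟫⁻ {x} x∈ with P? x | trans (sym (lookup∘tabulate (does ∘ P?) x)) ([]=⇒lookup x∈)
  ... | yes px | _ = px

x∉p-x : ∀ {n} {x} (p : Subset n) → x ∉ p - x
x∉p-x {x = suc x} (true  ∷ p) (there x∈) = x∉p-x p x∈
x∉p-x {x = suc x} (false ∷ p) (there x∈) = x∉p-x p x∈
x∉p-x {x = zero}  (true  ∷ p) ()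
x∉p-x {x = zero}  (false ∷ p) ()

_∈ˡ?_ : ∀ {n} (x : Fin n) (xs : List (Fin n)) → Dec (x List.∈ xs)
_∈ˡ?_ = DecMembership._∈?_ Fin._≟_

-- Walks and connections inside a vertex set

module Walks (G : Graph) where
  open Graph G renaming (sym to ~-sym)

  Within : (Vertex → Set) → Vertex → Vertex → Set
  Within P a b = P a × P b × a ~ b

  -- For `P = (_∈ B)` this is the relation in `ConnectedOn B`. The empty connection demands nothing
  -- of its endpoint, so `P a` has to be supplied separately where it matters.
  Conn : (Vertex → Set) → Vertex → Vertex → Set
  Conn P = Star (Within P)

  Conn-sym : ∀ {P a b} → Conn P a b → Conn P b a
  Conn-sym = reverse λ { (pa , pb , e) → pb , pa , ~-sym e }

  Conn-mono : ∀ {P Q : Vertex → Set} → (∀ {x} → P x → Q x) → ∀ {a b} → Conn P a b → Conn Q a b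
  Conn-mono P⇒Q = gmap _ λ { (pa , pb , e) → P⇒Q pa , P⇒Q pb , e }

  ~⇒≢ : ∀ {a b} → a ~ b → a ≢ b
  ~⇒≢ e eq = irrefl eq e

  start∈ : ∀ {a b} (w : Walk a b) → a List.∈ vertices w
  start∈ ε       = here refl
  start∈ (_ ◅ _) = here refl

  end∈ : ∀ {a b} (w : Walk a b) → b List.∈ vertices w
  end∈ ε       = here refl
  end∈ (_ ◅ w) = there (end∈ w)

  Conn-end : ∀ {P a b} (w : Walk a b) → (∀ {x} → x List.∈ vertices w → P x) →
    ∀ {y} → y List.∈ vertices w → Conn P y b
  Conn-end ε       inP (here refl) = ε
  Conn-end (e ◅ w) inP (here refl) =
    (inP (here refl) , inP (there (start∈ w)) , e) ◅ Conn-end w (inP ∘ there) (start∈ w)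
  Conn-end (e ◅ w) inP (there y∈)  = Conn-end w (inP ∘ there) y∈

  Conn⇒Walk : ∀ {P a b} → P a → Conn P a b →
    Σ[ w ∈ Walk a b ] (∀ {x} → x List.∈ vertices w → P x)
  Conn⇒Walk pa ε = ε , λ { (here refl) → pa }
  Conn⇒Walk pa ((_ , pb , e) ◅ c) with Conn⇒Walk pb c
  ... | w , inP = e ◅ w , λ { (here refl) → pa ; (there x∈) → inP x∈ }

  suffix : ∀ {a b x} (w : Walk a b) → Unique (vertices w) → x List.∈ vertices w →
    Σ[ w′ ∈ Walk x b ] (Unique (vertices w′) × (∀ {y} → y List.∈ vertices w′ → y List.∈ vertices w)
      × walkLength w′ ≤ walkLength w)
  suffix ε       u       (here refl) = ε , u , (λ y∈ → y∈) , z≤n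
  suffix (e ◅ w) u       (here refl) = e ◅ w , u , (λ y∈ → y∈) , ≤-refl
  suffix (e ◅ w) (_ ∷ u) (there x∈) with suffix w u x∈
  ... | w′ , u′ , w′⊆w , ℓ≤ = w′ , u′ , there ∘ w′⊆w , m≤n⇒m≤1+n ℓ≤

  -- Containment keeps an avoided vertex avoided, and the length bound keeps a shortest walk
  -- shortest.
  loopErase : ∀ {a b} (w : Walk a b) →
    Σ[ w′ ∈ Walk a b ] (Unique (vertices w′) × (∀ {y} → y List.∈ vertices w′ → y List.∈ vertices w)
      × walkLength w′ ≤ walkLength w)
  loopErase ε = ε , [] ∷ [] , (λ y∈ → y∈) , z≤n
  loopErase {a} (e ◅ w) with loopErase w
  ... | w′ , u′ , w′⊆w , ℓ≤ with a ∈ˡ? vertices w′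
  ...   | no a∉ = e ◅ w′ , All.¬Any⇒All¬ _ a∉ ∷ u′ ,
                  (λ { (here eq) → here eq ; (there y∈) → there (w′⊆w y∈) }) , s≤s ℓ≤
  ...   | yes a∈ with suffix w′ u′ a∈
  ...     | w″ , u″ , w″⊆w′ , ℓ′≤ =
            w″ , u″ , there ∘ w′⊆w ∘ w″⊆w′ , m≤n⇒m≤1+n (≤-trans ℓ′≤ ℓ≤)

  -- Deleting one vertex from a simple walk leaves at most two pieces, each of which holds an end of
  -- the walk.
  split : ∀ {a b x} (w : Walk a b) → Unique (vertices w) → ∀ {y} → y List.∈ vertices w → y ≢ x →
    Conn (λ z → z List.∈ vertices w × z ≢ x) y a ⊎ Conn (λ z → z List.∈ vertices w × z ≢ x) y b
  split ε u (here refl) y≢x = inj₁ ε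
  split (e ◅ w) u (here refl) y≢x = inj₁ ε
  split {a} {x = x} (_◅_ {j = a′} e w) (a∉ ∷ u) {y} (there y∈) y≢x with a Fin.≟ x
  ... | yes refl = inj₂ (Conn-end w (λ z∈ → there z∈ , λ { refl → lookup a∉ z∈ refl }) y∈)
  ... | no a≢x with split {x = x} w u y∈ y≢x
  ...   | inj₂ c = inj₂ (Conn-mono (λ (z∈ , z≢) → there z∈ , z≢) c)
  ...   | inj₁ c with a′ Fin.≟ x
  ...     | no a′≢x = inj₁ (Conn-mono (λ (z∈ , z≢) → there z∈ , z≢) c ◅◅
                            ((there (start∈ w) , a′≢x) , (here refl , a≢x) , ~-sym e) ◅ ε)
  -- Every vertex of a nonempty connection differs from `x`, yet it would end in `a′ = x`; the empty
  -- one would give `y = x`.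
  ...     | yes refl with Conn-sym c
  ...       | ε = contradiction refl y≢x
  ...       | ((_ , a′≢a′) , _) ◅ _ = contradiction refl a′≢a′

  -- Existence of shortest paths

  walk? : ∀ m u v → Dec (Σ[ w ∈ Walk u v ] walkLength w ≡ m)
  walk? zero    u v = map′ (λ { refl → ε , refl }) (λ { (ε , _) → refl }) (u Fin.≟ v)
  walk? (suc m) u v =
    map′ (λ { (_ , e , w , eq) → e ◅ w , cong suc eq })
         (λ { (e ◅ w , eq) → _ , e , w , suc-injective eq })
         (Fin.any? λ x → (u ~? x) ×-dec walk? m x v)

  shortestWalk : ∀ {u v} → Walk u v → Σ[ w ∈ Walk u v ] (∀ w′ → walkLength w ≤ walkLength w′)
  shortestWalk {u} {v} w = go w (<-wellFounded _)
    where
    go : (w : Walk u v) → Acc _<_ (walkLength w) → Σ[ w ∈ Walk u v ] (∀ w′ → walkLength w ≤ walkLength w′)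
    go w (acc rec) with anyUpTo? (λ m → walk? m u v) (walkLength w)
    ... | yes (_ , m<ℓ , w′ , refl) = go w′ (rec m<ℓ)
    ... | no none = w , λ w′ → ≮⇒≥ λ ℓ′<ℓ → none (_ , ℓ′<ℓ , w′ , refl)

  shortestPath : ∀ {u v} → Walk u v → ShortestPath u v
  shortestPath w with shortestWalk w
  ... | w₀ , min with loopErase w₀
  ...   | w₁ , uniq , _ , ℓ≤ = record
          { path     = record { walk = w₁ ; simple = uniq }
          ; shortest = λ q → ≤-trans ℓ≤ (min (walk q))
          }

  -- Simplicial vertices, shortest paths and biconnected components

  Simplicial : Vertex → Set
  Simplicial v = ∀ {a b} → v ~ a → v ~ b → a ≢ b → a ~ b

  -- The vertices before and after `v` are both neighbours of `v`, hence equal or adjacent; either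
  -- way `v` can be left out.
  bypass : ∀ {s t v} → Simplicial v → s ~ v → (w : Walk v t) → v ≢ t →
    Σ[ w′ ∈ Walk s t ] walkLength w′ < suc (walkLength w)
  bypass sv e ε v≢t = contradiction refl v≢t
  bypass {s} sv e (_◅_ {j = b} f w) _ with s Fin.≟ b
  ... | yes refl = w , m≤n⇒m≤1+n ≤-refl
  ... | no s≢b   = sv (~-sym e) f s≢b ◅ w , ≤-refl

  shortcut : ∀ {s t v} → Simplicial v → (w : Walk s t) → v List.∈ vertices w → v ≢ s → v ≢ t →
    Σ[ w′ ∈ Walk s t ] walkLength w′ < walkLength w
  shortcut sv ε       (here refl) v≢s _ = contradiction refl v≢s
  shortcut sv (e ◅ w) (here refl) v≢s _ = contradiction refl v≢s
  shortcut {v = v} sv (_◅_ {j = a} e w) (there v∈) v≢s v≢t with v Fin.≟ a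
  ... | yes refl = bypass sv e w v≢t
  ... | no v≢a with shortcut sv w v∈ v≢a v≢t
  ...   | w′ , ℓ< = e ◅ w′ , s≤s ℓ<

  Simplicial⇒∈ : ∀ {S v} → Simplicial v → IsStrongGeodetic S → v ∈ S
  Simplicial⇒∈ {S} {v} sv (I , covers) with v ∈? S
  ... | yes v∈S = v∈S
  ... | no  v∉S with covers v v∉S
  ...   | s , t , s∈S , t∈S , s<t , v∈p
        with shortcut sv (walk (path p)) v∈p (λ { refl → v∉S s∈S }) (λ { refl → v∉S t∈S })
        where p = I s∈S t∈S s<t
  ...     | w , ℓ< with loopErase w
  ...       | w′ , uniq , _ , ℓ≤ = contradiction
              (≤-trans (shortest (I s∈S t∈S s<t) (record { walk = w′ ; simple = uniq })) ℓ≤) (<⇒≱ ℓ<)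

  -- Biconnectivity need not be decided: double negation suffices, as adjacency is decidable.
  componentAbove : ∀ {C} → Biconnected C → ¬ ¬ (Σ[ B ∈ Subset order ] (BiconnectedComponent B × C ⊆ B))
  componentAbove {C} bic = go order bic (m≤m+n order ∣ C ∣)
    where
    -- The fuel is at least the number of vertices outside `C`, and every enlargement of `C` spends
    -- one unit.
    go : ∀ fuel {C} → Biconnected C → order ≤ fuel + ∣ C ∣ →
      ¬ ¬ (Σ[ B ∈ Subset order ] (BiconnectedComponent B × C ⊆ B))
    go fuel {C} bic big none = none (C , (bic , maximal) , λ x∈ → x∈)
      where
      absurd : ∀ fuel {D} → order ≤ fuel + ∣ C ∣ → Biconnected D → C ⊆ D → ∣ C ∣ < ∣ D ∣ → ⊥
      absurd zero    {D} big _    _   C<D = <-irrefl refl (<-≤-trans C<D (≤-trans (∣p∣≤n D) big))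
      absurd (suc f) {D} big bicD C⊆D C<D = go f bicD
        (≤-trans big (≤-trans (≤-reflexive (sym (+-suc f ∣ C ∣))) (+-monoʳ-≤ f C<D)))
        λ { (B , comp , D⊆B) → none (B , comp , D⊆B ∘ C⊆D) }

      maximal : ∀ D → Biconnected D → C ⊆ D → D ⊆ C
      maximal D bicD C⊆D {x} x∈D with x ∈? C
      ... | yes x∈C = x∈C
      ... | no  x∉C = ⊥-elim (absurd fuel big bicD C⊆D (p⊂q⇒∣p∣<∣q∣ (C⊆D , x , x∈D , x∉C)))

-- Separation in block graphs

module BlockGraph (G : Graph) (block : Graph.IsBlockGraph G) where
  open Graph G renaming (sym to ~-sym)
  open Walks G

  -- Deleting `v` leaves the walk `p`. Deleting any other vertex cuts `p` into pieces that each hold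
  -- an end of `p`, and both ends are adjacent to `v`.
  cycle-biconnected : ∀ {u v w} → v ~ u → v ~ w → (p : Walk u w) → Unique (vertices p) →
    (∀ {x} → x List.∈ vertices p → x ≢ v) →
    Biconnected ⟪ _∈ˡ? (v ∷ vertices p) ⟫
  cycle-biconnected {u} {v} {w} v~u v~w p uniq avoids =
    (v , v∈C) , (λ x∈ y∈ → toV x∈ ◅◅ Conn-sym (toV y∈)) , delete
    where
    C? : Decidable (List._∈ (v ∷ vertices p))
    C? = _∈ˡ? (v ∷ vertices p)
    C = ⟪ C? ⟫

    v∈C : v ∈ C
    v∈C = ∈⟪⟫⁺ C? (here refl)

    p⊆C : ∀ {x} → x List.∈ vertices p → x ∈ C
    p⊆C x∈p = ∈⟪⟫⁺ C? (there x∈p)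

    toV : ∀ {x} → x ∈ C → Conn (_∈ C) x v
    toV x∈C with ∈⟪⟫⁻ C? x∈C
    ... | here refl = ε
    ... | there x∈p = Conn-end p p⊆C x∈p ◅◅ (p⊆C (end∈ p) , v∈C , ~-sym v~w) ◅ ε

    delete : ∀ {x} → x ∈ C → ConnectedOn (C - x)
    delete {x} _ with x Fin.≟ v
    ... | yes refl = λ y∈ z∈ → toW y∈ ◅◅ Conn-sym (toW z∈)
      where
      toW : ∀ {y} → y ∈ C - x → Conn (_∈ (C - x)) y w
      toW y∈ with ∈⟪⟫⁻ C? (p─q⊆p C _ y∈)
      ... | here refl = contradiction y∈ (x∉p-x C)
      ... | there y∈p = Conn-end p (λ z∈p → x∈p∧x≢y⇒x∈p-y (p⊆C z∈p) (avoids z∈p)) y∈p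
    ... | no x≢v = λ y∈ z∈ → toV′ y∈ ◅◅ Conn-sym (toV′ z∈)
      where
      v∈ : v ∈ C - x
      v∈ = x∈p∧x≢y⇒x∈p-y v∈C (x≢v ∘ sym)

      p⊆ : ∀ {z} → z List.∈ vertices p × z ≢ x → z ∈ C - x
      p⊆ (z∈p , z≢x) = x∈p∧x≢y⇒x∈p-y (p⊆C z∈p) z≢x

      step : ∀ {y e} → y ∈ C - x → v ~ e → Conn (λ z → z List.∈ vertices p × z ≢ x) y e →
        Conn (_∈ (C - x)) y v
      -- That `e` survives the deletion is read off the last edge of the connection; if there is
      -- none, `e` is `y`.
      step y∈ v~e c with Conn-sym c
      ... | ε = (y∈ , v∈ , ~-sym v~e) ◅ ε
      ... | (e∈ , _) ◅ _ = Conn-mono p⊆ c ◅◅ (p⊆ e∈ , v∈ , ~-sym v~e) ◅ ε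

      toV′ : ∀ {y} → y ∈ C - x → Conn (_∈ (C - x)) y v
      toV′ y∈ with ∈⟪⟫⁻ C? (p─q⊆p C _ y∈)
      ... | here refl = ε
      ... | there y∈p with split p uniq y∈p (λ { refl → x∉p-x C y∈ })
      ...   | inj₁ c = step y∈ v~u c
      ...   | inj₂ c = step y∈ v~w c

  separates : ∀ {u v w} → v ~ u → v ~ w → u ≢ w → ¬ u ~ w → ¬ Conn (_≢ v) u w
  separates {u} {v} {w} v~u v~w u≢w u≁w c
    with Conn⇒Walk (~⇒≢ (~-sym v~u)) c
  ... | p₀ , avoids with loopErase p₀
  ...   | p , uniq , p⊆p₀ , _ =
    -- The goal is empty, so the doubly negated component can be used.
    componentAbove (cycle-biconnected v~u v~w p uniq (avoids ∘ p⊆p₀)) λ { (B , comp , C⊆B) →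
      u≁w (block B comp (C⊆B (∈⟪⟫⁺ C? (there (start∈ p)))) (C⊆B (∈⟪⟫⁺ C? (there (end∈ p)))) u≢w) }
    where
    C? : Decidable (List._∈ (v ∷ vertices p))
    C? = _∈ˡ? (v ∷ vertices p)

  -- If neighbours `a` and `b` of `v` other than `u` were not adjacent, then `a`, `v`, `b` would be
  -- a path avoiding `u` between two non-adjacent neighbours of `u`.
  dominated⇒Simplicial : ∀ {u v} → v ~ u → (∀ {w} → v ~ w → w ≢ u → u ~ w) → Simplicial v
  dominated⇒Simplicial {u} {v} v~u dom {a} {b} v~a v~b a≢b with a Fin.≟ u | b Fin.≟ u
  ... | yes refl | _        = dom v~b (a≢b ∘ sym)
  ... | no a≢u   | yes refl = ~-sym (dom v~a a≢u)
  ... | no a≢u   | no b≢u   = decidable-stable (a ~? b) λ a≁b →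
    separates (dom v~a a≢u) (dom v~b b≢u) a≢b a≁b
      ((a≢u , ~⇒≢ v~u , ~-sym v~a) ◅ (~⇒≢ v~u , b≢u , v~b) ◅ ε)

  -- A set containing all vertices that do not branch is strong geodetic

  Branching : Vertex → Set
  Branching v = ∃[ a ] ∃[ b ] (v ~ a × v ~ b × a ≢ b × ¬ a ~ b)

  module _ {S : Subset order} (branching : ∀ {v} → v ∉ S → Branching v) where

    -- The simple path is read backwards: it ends in `v` and grows at `x`. The fuel can only run out
    -- once the path has more than `order` vertices. New vertices are off the path, hence different
    -- from `v`.
    reach-∈S : ∀ fuel {x v} (w : Walk x v) → Unique (vertices w) → x ≢ v →
      order < fuel + length (vertices w) → Σ[ s ∈ Vertex ] (s ∈ S × Conn (_≢ v) x s)
    reach-∈S zero w uniq _ big = contradiction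
      (≤-trans (length-mono-Unique uniq λ {x} _ → ∈-allFin x) (≤-reflexive (length-tabulate _))) (<⇒≱ big)
    reach-∈S (suc _) ε _ x≢v _ = contradiction refl x≢v
    reach-∈S (suc f) {x} {v} p@(e ◅ w) (x∉ ∷ uniq) x≢v big with x ∈? S
    ... | yes x∈S = x , x∈S , ε
    ... | no  x∉S with leave (branching x∉S)
      where
      avoids : ∀ {z} → z List.∈ vertices w → z ≢ x
      avoids z∈ refl = lookup x∉ z∈ refl

      leave : Branching x → ∃[ c ] (x ~ c × ¬ c List.∈ vertices w)
      leave (a , b , x~a , x~b , a≢b , a≁b) with a ∈ˡ? vertices w | b ∈ˡ? vertices w
      ... | no a∉  | _      = a , x~a , a∉
      ... | yes _  | no b∉  = b , x~b , b∉
      -- Both would be joined to `v` along `w`, which avoids `x`.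
      ... | yes a∈ | yes b∈ = contradiction
        (Conn-end w avoids a∈ ◅◅ Conn-sym (Conn-end w avoids b∈)) (separates x~a x~b a≢b a≁b)
    ...   | c , x~c , c∉ with reach-∈S f (~-sym x~c ◅ p)
            (((~⇒≢ x~c ∘ sym) ∷ All.¬Any⇒All¬ _ c∉) ∷ x∉ ∷ uniq) (λ { refl → c∉ (end∈ w) })
            (≤-trans big (≤-reflexive (sym (+-suc f _))))
    ...     | s , s∈S , c⋯s = s , s∈S , (x≢v , (λ { refl → c∉ (end∈ w) }) , x~c) ◅ c⋯s

    liesOn-separated : ∀ {v s t} (p : ShortestPath s t) → ¬ Conn (_≢ v) s t → v liesOn p
    liesOn-separated {v} p sep = decidable-stable (v ∈ˡ? vertices (walk (path p))) λ v∉ →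
      sep (Conn-end (walk (path p)) (λ { x∈ refl → v∉ x∈ }) (start∈ (walk (path p))))

    -- The choice of shortest paths is immaterial: `v` separates the vertices of `S` reached through
    -- `a` and through `b`.
    isStrongGeodetic : Connected → IsStrongGeodetic S
    isStrongGeodetic conn = I , covers
      where
      I : ShortestPathAssignment S
      I _ _ _ = shortestPath (conn _ _)

      covers : ∀ v → v ∉ S → ∃[ s ] ∃[ t ] Σ[ s∈S ∈ s ∈ S ] Σ[ t∈S ∈ t ∈ S ] Σ[ s<t ∈ s Fin.< t ]
        v liesOn I s∈S t∈S s<t
      covers v v∉S with branching v∉S
      ... | a , b , v~a , v~b , a≢b , a≁b with reach v~a | reach v~b
        where
        reach : ∀ {x} → v ~ x → Σ[ s ∈ Vertex ] (s ∈ S × Conn (_≢ v) x s)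
        reach {x} v~x = reach-∈S order (~-sym v~x ◅ ε) (((~⇒≢ v~x ∘ sym) ∷ []) ∷ [] ∷ []) (~⇒≢ v~x ∘ sym)
          (m<m+n order (s≤s z≤n))
      ...   | s , s∈S , a⋯s | t , t∈S , b⋯t with Fin.<-cmp s t
      ...     | tri≈ _ refl _ = contradiction (a⋯s ◅◅ Conn-sym b⋯t) (separates v~a v~b a≢b a≁b)
      ...     | tri< s<t _ _ = s , t , s∈S , t∈S , s<t ,
                liesOn-separated (I s∈S t∈S s<t)
                  λ c → separates v~a v~b a≢b a≁b (a⋯s ◅◅ c ◅◅ Conn-sym b⋯t)
      ...     | tri> _ _ t<s = t , s , t∈S , s∈S , t<s ,
                liesOn-separated (I t∈S s∈S t<s)
                  λ c → separates v~a v~b a≢b a≁b (a⋯s ◅◅ Conn-sym c ◅◅ Conn-sym b⋯t)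

-- Prefix sums and concatenated lists

contents-prefixSums-zero : ∀ s xs → contents (prefixSums s xs) 0 ≡ s
contents-prefixSums-zero s []       = refl
contents-prefixSums-zero s (_ ∷ _)  = refl

contents-prefixSums-suc : ∀ s xs {i} → i < length xs →
  contents (prefixSums s xs) (suc i) ≡ contents (prefixSums s xs) i + contents xs i
contents-prefixSums-suc s (x ∷ xs) {zero}  _         = contents-prefixSums-zero (s + x) xs
contents-prefixSums-suc s (x ∷ xs) {suc i} (s≤s i<)  = contents-prefixSums-suc (s + x) xs i<

contents-prefixSums-length : ∀ s xs → contents (prefixSums s xs) (length xs) ≡ s + sum xs
contents-prefixSums-length s []       = sym (+-identityʳ s)
contents-prefixSums-length s (x ∷ xs) = trans (contents-prefixSums-length (s + x) xs) (+-assoc s x (sum xs))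

contents-map : ∀ {A : Set} (P : ℕ → Set) (f : A → ℕ) → (∀ x → P (f x)) →
  ∀ xs {p} → p < length xs → P (contents (map f xs) p)
contents-map P f pf (x ∷ xs) {zero}  _        = pf x
contents-map P f pf (x ∷ xs) {suc p} (s≤s p<) = contents-map P f pf xs p<

length-concat : ∀ {A : Set} (xss : List (List A)) → length (concat xss) ≡ sum (map length xss)
length-concat []         = refl
length-concat (xs ∷ xss) = trans (length-++ xs) (cong (length xs +_) (length-concat xss))

module Segments {A : Set} (f : A → ℕ) where

  offsets : ∀ {n} → ℕ → (Fin n → List A) → ℕ → ℕ
  offsets s g = contents (prefixSums s (List.tabulate (length ∘ g)))

  flat : ∀ {n} → (Fin n → List A) → ℕ → ℕ
  flat g = contents (map f (concat (List.tabulate g)))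

  -- Offsets count from `s` but positions in `flat` from 0, hence `s + p`. The start varies so that
  -- induction can pass to the remaining lists.
  Segment : ∀ {n} → ℕ → (Fin n → List A) → ℕ → ℕ → Set
  Segment s g v p = offsets s g v ≤ s + p × s + p < offsets s g (suc v)

  contents-++ˡ : ∀ xs {ys} {x} (x∈ : x List.∈ xs) → contents (map f (xs ++ ys)) (toℕ (index x∈)) ≡ f x
  contents-++ˡ (_ ∷ _)  (here refl) = refl
  contents-++ˡ (_ ∷ xs) (there x∈)  = contents-++ˡ xs x∈

  contents-++ˡ⁻ : ∀ xs {ys p} → p < length xs → ∃[ x ] (x List.∈ xs × contents (map f (xs ++ ys)) p ≡ f x)
  contents-++ˡ⁻ (x ∷ xs) {p = zero}  _        = x , here refl , refl
  contents-++ˡ⁻ (_ ∷ xs) {p = suc p} (s≤s p<) with contents-++ˡ⁻ xs p<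
  ... | x , x∈ , eq = x , there x∈ , eq

  contents-++ʳ : ∀ xs {ys} p → contents (map f (xs ++ ys)) (length xs + p) ≡ contents (map f ys) p
  contents-++ʳ []       p = refl
  contents-++ʳ (_ ∷ xs) p = contents-++ʳ xs p

  offsets-lower : ∀ {n} s (g : Fin n → List A) (v : Fin n) → s ≤ offsets s g (toℕ v)
  offsets-lower s g zero    = ≤-refl
  offsets-lower s g (suc v) = ≤-trans (m≤m+n s _) (offsets-lower (s + length (g zero)) (g ∘ suc) v)

  segment⁺ : ∀ {n} s (g : Fin n → List A) v {x} → x List.∈ g v →
    ∃[ p ] (Segment s g (toℕ v) p × flat g p ≡ f x)
  segment⁺ s g zero x∈ = toℕ (index x∈) ,
    (m≤m+n s _ , ≤-trans (+-monoʳ-< s (Fin.toℕ<n (index x∈))) (≤-reflexive (sym (contents-prefixSums-zero _ (List.tabulate (length ∘ g ∘ suc)))))) ,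
    contents-++ˡ (g zero) x∈
  segment⁺ s g (suc v) x∈ with segment⁺ (s + length (g zero)) (g ∘ suc) v x∈
  ... | p , (lo , hi) , eq = length (g zero) + p ,
    (≤-trans lo (≤-reflexive (+-assoc s _ p)) , ≤-trans (s≤s (≤-reflexive (sym (+-assoc s _ p)))) hi) ,
    trans (contents-++ʳ (g zero) p) eq

  segment⁻ : ∀ {n} s (g : Fin n → List A) v {p} → Segment s g (toℕ v) p →
    ∃[ x ] (x List.∈ g v × flat g p ≡ f x)
  segment⁻ s g zero (_ , hi) = contents-++ˡ⁻ (g zero)
    (+-cancelˡ-< s _ _ (≤-trans hi (≤-reflexive (contents-prefixSums-zero _ (List.tabulate (length ∘ g ∘ suc))))))
  -- Offsets never fall below their start, so `p` lies past the first list and `q` is its position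
  -- in the rest.
  segment⁻ s g (suc v) {p} (lo , hi) with m≤n⇒∃[o]m+o≡n
    (+-cancelˡ-≤ s _ _ (≤-trans (offsets-lower (s + length (g zero)) (g ∘ suc) v) lo))
  ... | q , refl with segment⁻ (s + length (g zero)) (g ∘ suc) v {q}
        (≤-trans lo (≤-reflexive (sym (+-assoc s _ q))) , ≤-trans (s≤s (≤-reflexive (+-assoc s _ q))) hi)
  ...   | x , x∈ , eq = x , x∈ , trans (contents-++ʳ (g zero) q) eq

-- The arrays of the input and the number of arcs

module Layout (G : Graph) (L : AdjacencyLists G) (k : ℕ) where
  open Graph G renaming (sym to ~-sym)
  open AdjacencyLists L
  open Segments {Vertex} toℕ

  lists : List (List Vertex)
  lists = map neighbours (allFin order)

  off adj deg : ℕ → ℕ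
  off = input G L k 1
  adj = input G L k 2
  deg = contents (map length lists)

  lists≡ : lists ≡ List.tabulate neighbours
  lists≡ = map-tabulate id neighbours

  lengths≡ : map length lists ≡ List.tabulate (length ∘ neighbours)
  lengths≡ = trans (cong (map length) lists≡) (map-tabulate neighbours length)

  length-lengths : length (map length lists) ≡ order
  length-lengths = trans (cong length lengths≡) (length-tabulate _)

  off-zero : off 0 ≡ 0
  off-zero = contents-prefixSums-zero 0 (map length lists)

  off-suc : ∀ {v} → v < order → off (suc v) ≡ off v + deg v
  off-suc v< = contents-prefixSums-suc 0 (map length lists) (≤-trans v< (≤-reflexive (sym length-lengths)))

  off-order : off order ≡ length (concat lists)
  off-order = trans (cong off (sym length-lengths))
    (trans (contents-prefixSums-length 0 (map length lists)) (sym (length-concat lists)))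

  adj< : ∀ {p} → p < off order → adj p < order
  adj< p< = contents-map (_< order) toℕ Fin.toℕ<n (concat lists) (≤-trans p< (≤-reflexive off-order))

  arc⁺ : ∀ {v w} → v ~ w → ∃[ p ] (off (toℕ v) ≤ p × p < off (suc (toℕ v)) × adj p ≡ toℕ w)
  arc⁺ {v} v~w rewrite lengths≡ | lists≡ with segment⁺ 0 neighbours v (Equivalence.from correct v~w)
  ... | p , (lo , hi) , eq = p , lo , hi , eq

  arc⁻ : ∀ {v w} → ∃[ p ] (off (toℕ v) ≤ p × p < off (suc (toℕ v)) × adj p ≡ w) → ∃[ x ] (v ~ x × w ≡ toℕ x)
  arc⁻ {v} (p , lo , hi , eq) rewrite lengths≡ | lists≡ with segment⁻ 0 neighbours v (lo , hi)
  ... | x , x∈ , eq′ = x , Equivalence.to correct x∈ , trans (sym eq) eq′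

  arcsFrom : Vertex → List (Vertex × Vertex)
  arcsFrom v = map (v ,_) (neighbours v)

  -- Tagging the list entries with their vertex makes them distinct, so they can be counted against
  -- the edges.
  arcs : List (Vertex × Vertex)
  arcs = concat (map arcsFrom (allFin order))

  length-arcs : length arcs ≡ length (concat lists)
  length-arcs = begin
    length arcs                                    ≡⟨ length-concat (map arcsFrom (allFin order)) ⟩
    sum (map length (map arcsFrom (allFin order))) ≡⟨ cong sum (map-∘ (allFin order)) ⟨
    sum (map (length ∘ arcsFrom) (allFin order))   ≡⟨ cong sum (map-cong (λ v → length-map (v ,_) (neighbours v)) (allFin order)) ⟩
    sum (map (length ∘ neighbours) (allFin order)) ≡⟨ cong sum (map-∘ (allFin order)) ⟩
    sum (map length lists)                         ≡⟨ length-concat lists ⟨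
    length (concat lists)                          ∎
    where open ≡-Reasoning

  arcs-Unique : Unique arcs
  arcs-Unique = Unique.concat⁺
    (All.map⁺ (All.tabulate⁺ λ v → Unique.map⁺ (λ { refl → refl }) (distinct v)))
    (AllPairs.map⁺ (AllPairs.map disjoint (Unique.allFin⁺ order)))
    where
    disjoint : ∀ {v w} → v ≢ w → ∀ {e} → ¬ (e List.∈ arcsFrom v × e List.∈ arcsFrom w)
    disjoint v≢w (e∈v , e∈w) with ∈-map⁻ _ e∈v | ∈-map⁻ _ e∈w
    ... | _ , _ , refl | _ , _ , refl = v≢w refl

  ∈-edges : ∀ {v w} → v Fin.< w → v ~ w → (v , w) List.∈ edges
  ∈-edges v<w v~w = ∈-filter⁺ (λ { (u , v) → (u Fin.<? v) ×-dec (u ~? v) })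
    (∈-cartesianProduct⁺ (∈-allFin _) (∈-allFin _)) (v<w , v~w)

  arcs⊆ : ∀ {e} → e List.∈ arcs → e List.∈ edges ++ map swap edges
  arcs⊆ e∈ with ∈-concat⁻′ (map arcsFrom (allFin order)) e∈
  ... | _ , e∈v , v∈ with ∈-map⁻ _ v∈
  ... | v , _ , refl with ∈-map⁻ _ e∈v
  ... | w , w∈ , refl with Fin.<-cmp v w
  ...   | tri< v<w _ _ = ∈-++⁺ˡ (∈-edges v<w (Equivalence.to correct w∈))
  ...   | tri≈ _ v≡w _ = contradiction (Equivalence.to correct w∈) (irrefl v≡w)
  ...   | tri> _ _ w<v = ∈-++⁺ʳ edges (∈-map⁺ swap (∈-edges w<v (~-sym (Equivalence.to correct w∈))))

  -- Every arc is an entry of `edges` or the reverse of one.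
  off-order≤ : off order ≤ size + size
  off-order≤ = begin
    off order                        ≡⟨ trans off-order (sym length-arcs) ⟩
    length arcs                      ≤⟨ length-mono-Unique arcs-Unique arcs⊆ ⟩
    length (edges ++ map swap edges) ≡⟨ trans (length-++ edges) (cong (size +_) (length-map swap edges)) ⟩
    size + size                      ∎
    where open ≤-Reasoning

-- Finite sums, counting and array updates

Σ< : ℕ → (ℕ → ℕ) → ℕ
Σ< zero    f = 0
Σ< (suc m) f = Σ< m f + f m

Σ<-mono : ∀ m {f g : ℕ → ℕ} → (∀ v → f v ≤ g v) → Σ< m f ≤ Σ< m g
Σ<-mono zero    f≤g = z≤n
Σ<-mono (suc m) f≤g = +-mono-≤ (Σ<-mono m f≤g) (f≤g m)

-- Slack at a single index survives in the sum. It becomes the credit released when a vertex is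
-- first met.
Σ<-mono-at : ∀ m {f g : ℕ → ℕ} {v d} → (∀ v → f v ≤ g v) → v < m → f v + d ≤ g v →
  Σ< m f + d ≤ Σ< m g
Σ<-mono-at (suc m) {f} {g} {v} {d} f≤g (s≤s v≤m) fv+d≤gv with v ≟ m
... | yes refl = ≤-trans (≤-reflexive (+-assoc (Σ< m f) (f m) d)) (+-mono-≤ (Σ<-mono m f≤g) fv+d≤gv)
... | no v≢m   = begin
  Σ< m f + f m + d   ≡⟨ exchange (Σ< m f) (f m) d ⟩
  Σ< m f + d + f m   ≤⟨ +-mono-≤ (Σ<-mono-at m f≤g (≤∧≢⇒< v≤m v≢m) fv+d≤gv) (f≤g m) ⟩
  Σ< m g + g m       ∎
  where
  open ≤-Reasoning
  exchange : ∀ a b c → a + b + c ≡ a + c + b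
  exchange = solve-∀

Σ<-cons : ∀ m (f : ℕ → ℕ) → Σ< (suc m) f ≡ f 0 + Σ< m (f ∘ suc)
Σ<-cons zero    f = sym (+-identityʳ (f 0))
Σ<-cons (suc m) f = trans (cong (_+ f (suc m)) (Σ<-cons m f)) (+-assoc (f 0) _ _)

-- Indicator of the statuses 0 and 1, which will turn out to be those of the simplicial vertices.
unbranched : ℕ → ℕ
unbranched (suc (suc _)) = 0
unbranched _             = 1

tally : (ℕ → ℕ) → ℕ → ℕ
tally s m = Σ< m (unbranched ∘ s)

tally≤ : ∀ s m → tally s m ≤ m
tally≤ s zero    = z≤n
tally≤ s (suc m) = ≤-trans (+-mono-≤ (tally≤ s m) (unbranched≤1 (s m))) (≤-reflexive (+-comm m 1))
  where
  unbranched≤1 : ∀ x → unbranched x ≤ 1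
  unbranched≤1 zero          = ≤-refl
  unbranched≤1 (suc zero)    = ≤-refl
  unbranched≤1 (suc (suc _)) = z≤n

-- Cardinality unfolds at the first index and `tally` at the last; `Σ<-cons` mediates. This
-- identifies the counter of the program with the size of a set.
∣⟪≤1⟫∣ : ∀ n (s : ℕ → ℕ) → ∣ ⟪ (λ (v : Fin n) → s (toℕ v) ≤? 1) ⟫ ∣ ≡ tally s n
∣⟪≤1⟫∣ zero    s = refl
∣⟪≤1⟫∣ (suc n) s = trans (head (s 0) ⟪ (λ (v : Fin n) → s (suc (toℕ v)) ≤? 1) ⟫) (trans (cong (unbranched (s 0) +_) (∣⟪≤1⟫∣ n (s ∘ suc)))
                                          (sym (Σ<-cons n (unbranched ∘ s))))
  where
  head : ∀ x {n} (p : Subset n) → ∣ does (x ≤? 1) ∷ p ∣ ≡ unbranched x + ∣ p ∣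
  head zero          p = refl
  head (suc zero)    p = refl
  head (suc (suc _)) p = refl

-- For a literal `a`, the memory `μ [ a , i ↦ x ]` at `a` reduces to this form and at any other
-- literal to `μ`, so invariants about untouched arrays carry over as they are.
_[_]:=_ : (ℕ → ℕ) → ℕ → ℕ → ℕ → ℕ
(s [ i ]:= x) j = if does (i ≟ j) then x else s j

module _ (s : ℕ → ℕ) (i x : ℕ) where

  -- Replaces a case distinction at every read after a write. A motive with a premise such as
  -- `w ≡ v` specialises it to one index.
  :=-elim : (P : ℕ → ℕ → Set) → P i x → (∀ j → j ≢ i → P j (s j)) → ∀ j → P j ((s [ i ]:= x) j)
  :=-elim P px ps j with i ≡ᵇ j | ≡ᵇ⇒≡ i j | ≡⇒≡ᵇ i j
  ... | true  | i≡j | _   = subst (λ j → P j x) (i≡j _) px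
  ... | false | _   | i≢j = ps j λ j≡i → i≢j (sym j≡i)

  :=-this : (s [ i ]:= x) i ≡ x
  :=-this = :=-elim (λ j y → j ≡ i → y ≡ x) (λ _ → refl) (λ j j≢i j≡i → contradiction j≡i j≢i) i refl

-- Total correctness with running time

Runs : ℕ → Program → Memory → (Memory → ℕ → Set) → Set
Runs W P μ Q = ∃[ ν ] ∃[ t ] ((W ⊢⟨ P , μ ⟩⇓ ν ∣ t) × Q ν t)

-- For closed numerals the hidden argument reduces to the unit type and is inferred.
evident : ∀ {m n} {_ : T (m ≤ᵇ n)} → m ≤ n
evident {m} {n} {p} = ≤ᵇ⇒≤ m n p

m+1+n≡o⇒m<o : ∀ {m n o} → m + suc n ≡ o → m < o
m+1+n≡o⇒m<o {m} eq = ≤-trans (m<m+n m (s≤s z≤n)) (≤-reflexive eq)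

-- Amortised analysis: Φ pays for work whose total is bounded globally, w for the
-- work of the individual iterations. Both occur additively on either side
-- so that no subtraction is needed.
while-Runs : ∀ {W e P} (I : ℕ → Memory → Set) (Φ : Memory → ℕ) (w : ℕ → ℕ) (m : ℕ) →
  (∀ {i μ} → I i μ → ⟦ e ⟧ μ ≡ m ∸ i) →
  (∀ {i μ} → i < m → I i μ →
    Runs W P μ λ ν t → I (suc i) ν × 1 + cost e + t + Φ ν + w i ≤ Φ μ + w (suc i)) →
  ∀ {i μ} → i ≤ m → I i μ →
  Runs W (while e P) μ λ ν t → I m ν × t + Φ ν + w i ≤ 1 + cost e + Φ μ + w m
while-Runs {W} {e} {P} I Φ w m guard body {i} i≤m = go (m ∸ i) i (m+[n∸m]≡n i≤m)
  where
  go : ∀ d i {μ} → i + d ≡ m → I i μ →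
    Runs W (while e P) μ λ ν t → I m ν × t + Φ ν + w i ≤ 1 + cost e + Φ μ + w m
  go zero i {μ} eq Iμ rewrite trans (sym (+-identityʳ i)) eq =
    μ , _ , while-false (trans (guard Iμ) (n∸n≡0 m)) , Iμ , ≤-refl
  go (suc d) i {μ} eq Iμ with body (m+1+n≡o⇒m<o eq) Iμ
  ... | ν , s , P⇓ , Iν , s≤ with go d (suc i) (trans (sym (+-suc i d)) eq) Iν
  ...   | ξ , t , while⇓ , Iξ , t≤ = ξ , _ ,
          while-true (λ z → m>n⇒m∸n≢0 (m+1+n≡o⇒m<o eq) (trans (sym (guard Iμ)) z)) P⇓ while⇓ , Iξ ,
          -- The bounds for the first iteration and for the rest are added; what belongs to the
          -- state between them occurs on both sides.
          +-cancelʳ-≤ (Φ ν + w (suc i)) _ _ (begin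
            1 + cost e + s + t + Φ ξ + w i + (Φ ν + w (suc i))
              ≡⟨ lhs (1 + cost e) s t (Φ ξ) (w i) (Φ ν) (w (suc i)) ⟩
            (1 + cost e + s + Φ ν + w i) + (t + Φ ξ + w (suc i))
              ≤⟨ +-mono-≤ s≤ t≤ ⟩
            (Φ μ + w (suc i)) + (1 + cost e + Φ ν + w m)
              ≡⟨ rhs (1 + cost e) (Φ μ) (w (suc i)) (Φ ν) (w m) ⟩
            1 + cost e + Φ μ + w m + (Φ ν + w (suc i)) ∎)
    where
    open ≤-Reasoning
    lhs : ∀ g s t φ w ψ w′ → g + s + t + φ + w + (ψ + w′) ≡ (g + s + ψ + w) + (t + φ + w′)
    lhs = solve-∀
    rhs : ∀ g φ w ψ w′ → (φ + w) + (g + ψ + w′) ≡ g + φ + w′ + (ψ + w)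
    rhs = solve-∀

-- The program

-- Registers and arrays: 3 is the current vertex v, 4 a position p in its list and 5 a
-- position q in the list of the vertex at p; 6 marks v and its neighbours by v + 1; 7 is the
-- status of a vertex (0: not met, 1: met, 2: has two non-adjacent neighbours); 8 is a counter.
$v $p $q : Expr
$v = 3 [ lit 0 ]
$p = 4 [ lit 0 ]
$q = 5 [ lit 0 ]

markBody markLoop checkBody checkLoop visit visitBody visitLoop : Program
round rounds countBody countLoop decide program : Program
markBody  = 6 [ 2 [ $p ] ]≔ $v ⊕ lit 1 ⨾ 4 [ lit 0 ]≔ $p ⊕ lit 1
markLoop  = while (1 [ $v ⊕ lit 1 ] ⊖ $p) markBody
-- By truncation the condition is nonzero exactly if the vertex at `q` carries a mark below `v + 1`.
checkBody = cond ($v ⊕ lit 1 ⊖ 6 [ 2 [ $q ] ]) (7 [ 2 [ $p ] ]≔ lit 2) skip ⨾ 5 [ lit 0 ]≔ $q ⊕ lit 1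
checkLoop = while (1 [ 2 [ $p ] ⊕ lit 1 ] ⊖ $q) checkBody
visit     = cond (7 [ 2 [ $p ] ]) skip
                 (7 [ 2 [ $p ] ]≔ lit 1 ⨾ 5 [ lit 0 ]≔ 1 [ 2 [ $p ] ] ⨾ checkLoop)
visitBody = visit ⨾ 4 [ lit 0 ]≔ $p ⊕ lit 1
visitLoop = while (1 [ $v ⊕ lit 1 ] ⊖ $p) visitBody
-- Two traversals of the list of `v`: all its neighbours must be marked before any list is compared
-- with the marks.
round     = 6 [ $v ]≔ $v ⊕ lit 1 ⨾ 4 [ lit 0 ]≔ 1 [ $v ] ⨾ markLoop ⨾
            4 [ lit 0 ]≔ 1 [ $v ] ⨾ visitLoop ⨾ 3 [ lit 0 ]≔ $v ⊕ lit 1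
rounds    = while (0 [ lit 0 ] ⊖ $v) round
-- Truncation sends the statuses 0 and 1 alike to 0, so both are counted.
countBody = cond (7 [ $v ] ⊖ lit 1) skip (8 [ lit 0 ]≔ 8 [ lit 0 ] ⊕ lit 1) ⨾ 3 [ lit 0 ]≔ $v ⊕ lit 1
countLoop = while (0 [ lit 0 ] ⊖ $v) countBody
decide    = cond (8 [ lit 0 ] ⊖ 0 [ lit 1 ]) (0 [ lit 0 ]≔ lit 0) (0 [ lit 0 ]≔ lit 1)
program   = rounds ⨾ 3 [ lit 0 ]≔ lit 0 ⨾ countLoop ⨾ decide

-- Correctness and running time over abstract offsets and targets

module Algorithm
  {W n k : ℕ} {off adj deg : ℕ → ℕ}
  (n≤W : n ≤ W) (M≤W : off n ≤ W) (2≤W : 2 ≤ W)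
  (off-zero : off 0 ≡ 0)
  (off-suc : ∀ {v} → v < n → off (suc v) ≡ off v + deg v)
  (adj< : ∀ {p} → p < off n → adj p < n)
  -- K bounds the time of one iteration of a loop, nested loops aside.
  (K : ℕ) (100≤K : 100 ≤ K)
  where

  Arc : ℕ → ℕ → Set
  Arc v w = ∃[ p ] (off v ≤ p × p < off (suc v) × adj p ≡ w)

  module Correctness (Arc-sym : ∀ {v w} → v < n → Arc v w → Arc w v) where

    -- Counterparts, in terms of the arrays, of `Branching` and of the hypothesis of
    -- `dominated⇒Simplicial`.
    Branch Dominated : ℕ → Set
    Branch v    = ∃[ a ] ∃[ b ] (Arc v a × Arc v b × a ≢ b × ¬ Arc a b)
    Dominated v = ∃[ a ] (Arc v a × (∀ b → Arc v b → b ≡ a ⊎ Arc a b))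

    off-step : ∀ {v} → v < n → off v ≤ off (suc v)
    off-step v<n = ≤-trans (m≤m+n _ _) (≤-reflexive (sym (off-suc v<n)))

    off≤M : ∀ {v} → v ≤ n → off v ≤ off n
    off≤M {v} v≤n = go (n ∸ v) v (m+[n∸m]≡n v≤n)
      where
      go : ∀ d v → v + d ≡ n → off v ≤ off n
      go zero    v eq = ≤-reflexive (cong off (trans (sym (+-identityʳ v)) eq))
      go (suc d) v eq = ≤-trans (off-step (m+1+n≡o⇒m<o eq))
                                (go d (suc v) (trans (sym (+-suc v d)) eq))

    target< : ∀ {v p} → v < n → p < off (suc v) → adj p < n
    target< v<n p< = adj< (<-≤-trans p< (off≤M v<n))

    next≤W : ∀ {v p} → v < n → p < off (suc v) → suc p ≤ W
    next≤W v<n p< = ≤-trans p< (≤-trans (off≤M v<n) M≤W)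

    -- A vertex not yet met holds the time for comparing its list.
    credit : ℕ → ℕ → ℕ
    credit zero    d = K * suc d
    credit (suc _) d = 0

    Φ : (ℕ → ℕ) → ℕ
    Φ s = Σ< n λ v → credit (s v) (deg v)

    -- A written status is nonzero, so a write can only give up credit.
    credit-set : ∀ (s : ℕ → ℕ) v x w → credit ((s [ v ]:= suc x) w) (deg w) ≤ credit (s w) (deg w)
    credit-set s v x = :=-elim s v (suc x) (λ w y → credit y (deg w) ≤ credit (s w) (deg w))
      z≤n (λ _ _ → ≤-refl)

    Φ-set : ∀ (s : ℕ → ℕ) v x → Φ (s [ v ]:= suc x) ≤ Φ s
    Φ-set s v x = Σ<-mono n (credit-set s v x)

    Φ-release : ∀ (s : ℕ → ℕ) {v} x → v < n → s v ≡ 0 → Φ (s [ v ]:= suc x) + K * suc (deg v) ≤ Φ s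
    Φ-release s {v} x v<n unseen = Σ<-mono-at n (credit-set s v x) v<n
      (≤-reflexive (trans (cong (λ y → credit y (deg v) + _) (:=-this s v (suc x)))
                          (cong (λ y → credit y (deg v)) (sym unseen))))

    -- The degrees add up to `off n`, so the credit available at the start is linear.
    Φ-unseen : (s : ℕ → ℕ) → (∀ v → s v ≡ 0) → Φ s ≡ K * (off n + n)
    Φ-unseen s s≡0 = go n ≤-refl
      where
      go : ∀ m → m ≤ n → Σ< m (λ v → credit (s v) (deg v)) ≡ K * (off m + m)
      go zero    _   = sym (trans (cong (λ o → K * (o + 0)) off-zero) (*-zeroʳ K))
      go (suc m) m<n rewrite go m (<⇒≤ m<n) | s≡0 m | off-suc m<n = arith K (off m) m (deg m)
        where
        arith : ∀ K o m d → K * (o + m) + K * suc d ≡ K * (o + d + suc m)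
        arith = solve-∀

    record Inputs (x₀ x₁ x₂ : ℕ → ℕ) : Set where
      field
        order≡  : x₀ 0 ≡ n
        bound≡  : x₀ 1 ≡ k
        off≡    : ∀ p → x₁ p ≡ off p
        adj≡    : ∀ p → x₂ p ≡ adj p
    open Inputs

    -- Only marks above `v` count. Those of earlier rounds are at most `v`, so the array need not be
    -- cleared. The vertex `v` is marked too, since it occurs in the lists compared with the marks.
    record Marked (v p : ℕ) (mark : ℕ → ℕ) : Set where
      field
        bounded  : ∀ w → mark w ≤ suc v
        sound    : ∀ w → v < mark w → w ≡ v ⊎ Arc v w
        self     : v < mark v
        complete : ∀ q → off v ≤ q → q < p → v < mark (adj q)
    open Marked

    -- p is a position in the list of v: the vertices listed before are seen.
    record Status (v p : ℕ) (status : ℕ → ℕ) : Set where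
      field
        bad     : ∀ w → 2 ≤ status w → Branch w
        good    : ∀ w → status w ≡ 1 → Dominated w
        seen    : ∀ {a w} → a < v → Arc a w → 0 < status w
        seenNow : ∀ q → off v ≤ q → q < p → 0 < status (adj q)
    open Status

    -- The list of a is being compared with the marks of v, up to position q.
    record Check (v p a q : ℕ) (status : ℕ → ℕ) : Set where
      field
        bad     : ∀ w → 2 ≤ status w → Branch w
        good    : ∀ w → w ≢ a → status w ≡ 1 → Dominated w
        seen    : ∀ {a w} → a < v → Arc a w → 0 < status w
        seenNow : ∀ q → off v ≤ q → q < suc p → 0 < status (adj q)
        current : status a ≡ 1 → ∀ r → off a ≤ r → r < q → adj r ≡ v ⊎ Arc v (adj r)
    module C = Check

    Marked-start : ∀ {v mark} → (∀ w → mark w ≤ v) → Marked v (off v) (mark [ v ]:= suc v)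
    Marked-start {v} {mark} old = record
      { bounded  = :=-elim mark v (suc v) (λ _ x → x ≤ suc v) ≤-refl (λ w _ → m≤n⇒m≤1+n (old w))
      ; sound    = :=-elim mark v (suc v) (λ w x → v < x → w ≡ v ⊎ Arc v w)
                     (λ _ → inj₁ refl) (λ w _ v<m → contradiction v<m (≤⇒≯ (old w)))
      ; self     = ≤-reflexive (sym (:=-this mark v (suc v)))
      ; complete = λ q ≤q q< → contradiction q< (≤⇒≯ ≤q)
      }

    Marked-step : ∀ {v p mark} → off v ≤ p → p < off (suc v) → Marked v p mark →
      Marked v (suc p) (mark [ adj p ]:= suc v)
    Marked-step {v} {p} {mark} ≤p p< m = record
      { bounded  = :=-elim mark (adj p) (suc v) (λ _ x → x ≤ suc v) ≤-refl (λ w _ → bounded m w)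
      ; sound    = :=-elim mark (adj p) (suc v) (λ w x → v < x → w ≡ v ⊎ Arc v w)
                     (λ _ → inj₂ (p , ≤p , p< , refl)) (λ w _ → sound m w)
      ; self     = :=-elim mark (adj p) (suc v) (λ w x → w ≡ v → v < x)
                     (λ _ → ≤-refl) (λ { _ _ refl → self m }) v refl
      ; complete = λ q ≤q q<1+p → :=-elim mark (adj p) (suc v) (λ w x → w ≡ adj q → v < x)
                     (λ _ → ≤-refl)
                     (λ { _ w≢ refl → complete m q ≤q (≤∧≢⇒< (≤-pred q<1+p) λ { refl → w≢ refl }) })
                     (adj q) refl
      }

    Check-start : ∀ {v p status} → off v ≤ p → p < off (suc v) → Status v p status →
      Check v p (adj p) (off (adj p)) (status [ adj p ]:= 1)
    Check-start {v} {p} {status} ≤p p< s = record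
      { bad     = :=-elim status (adj p) 1 (λ w x → 2 ≤ x → Branch w) (λ { (s≤s ()) }) (λ w _ → bad s w)
      ; good    = :=-elim status (adj p) 1 (λ w x → w ≢ adj p → x ≡ 1 → Dominated w)
                    (λ w≢ → contradiction refl w≢) (λ w _ _ → good s w)
      ; seen    = λ {_} {w} a<v arc → :=-elim status (adj p) 1 (λ w′ x → w′ ≡ w → 0 < x)
                    (λ _ → s≤s z≤n) (λ { _ _ refl → seen s a<v arc }) w refl
      ; seenNow = λ q ≤q q<1+p → :=-elim status (adj p) 1 (λ w x → w ≡ adj q → 0 < x)
                    (λ _ → s≤s z≤n)
                    (λ { _ w≢ refl → seenNow s q ≤q (≤∧≢⇒< (≤-pred q<1+p) λ { refl → w≢ refl }) })
                    (adj q) refl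
      ; current = λ _ q ≤q q< → contradiction q< (≤⇒≯ ≤q)
      }

    Check-bad : ∀ {v p a q status} → Branch a → Check v p a q status →
      Check v p a (suc q) (status [ a ]:= 2)
    Check-bad {v} {p} {a} {q} {status} br c = record
      { bad     = :=-elim status a 2 (λ w x → 2 ≤ x → Branch w) (λ _ → br) (λ w _ → C.bad c w)
      ; good    = :=-elim status a 2 (λ w x → w ≢ a → x ≡ 1 → Dominated w)
                    (λ _ ()) (λ w w≢ _ → C.good c w w≢)
      ; seen    = λ {_} {w} a<v arc → :=-elim status a 2 (λ w′ x → w′ ≡ w → 0 < x)
                    (λ _ → s≤s z≤n) (λ { _ _ refl → C.seen c a<v arc }) w refl
      ; seenNow = λ r ≤r r<1+p → :=-elim status a 2 (λ w x → w ≡ adj r → 0 < x)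
                    (λ _ → s≤s z≤n) (λ { _ _ refl → C.seenNow c r ≤r r<1+p }) (adj r) refl
      ; current = λ eq → contradiction (trans (sym (:=-this status a 2)) eq) λ ()
      }

    Check-good : ∀ {v p a q status} → adj q ≡ v ⊎ Arc v (adj q) → Check v p a q status →
      Check v p a (suc q) status
    Check-good {q = q} ok c = record
      { bad = C.bad c ; good = C.good c ; seen = C.seen c ; seenNow = C.seenNow c
      ; current = λ eq r ≤r r<1+q → current′ eq r ≤r (r ≟ q) r<1+q
      }
      where
      current′ : _ → ∀ r → _ → Dec (r ≡ q) → r < suc q → _
      current′ eq r ≤r (yes refl) _     = ok
      current′ eq r ≤r (no r≢q)   r<1+q = C.current c eq r ≤r (≤∧≢⇒< (≤-pred r<1+q) r≢q)

    -- If the status is still 1, the entire list of `a` has passed the comparison, and `v` is the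
    -- neighbour that dominates `a`.
    Check-end : ∀ {v p a status} → Arc a v → Check v p a (off (suc a)) status →
      Status v (suc p) status
    Check-end {v} {a = a} {status} arc c = record
      { bad = C.bad c ; good = good′ ; seen = C.seen c ; seenNow = C.seenNow c }
      where
      good′ : ∀ w → status w ≡ 1 → Dominated w
      good′ w eq with w ≟ a
      ... | no w≢a   = C.good c w w≢a eq
      ... | yes refl = v , arc , λ { _ (r , ≤r , r< , refl) → C.current c eq r ≤r r< }

    Status-skip : ∀ {v p status} → 0 < status (adj p) → Status v p status → Status v (suc p) status
    Status-skip {v} {p} {status} ps s = record
      { bad = bad s ; good = good s ; seen = seen s ; seenNow = λ q ≤q q< → now q ≤q q< (q ≟ p) }
      where
      now : ∀ q → off v ≤ q → q < suc p → Dec (q ≡ p) → 0 < status (adj q)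
      now q ≤q q< (yes refl) = ps
      now q ≤q q< (no q≢p)   = seenNow s q ≤q (≤∧≢⇒< (≤-pred q<) q≢p)

    Status-next : ∀ {v status} → Status v (off (suc v)) status → Status (suc v) (off (suc v)) status
    Status-next {v} {status} s = record
      { bad = bad s ; good = good s ; seen = λ {a} a< → seen′ a< (a ≟ v)
      ; seenNow = λ q ≤q q< → contradiction q< (≤⇒≯ ≤q) }
      where
      seen′ : ∀ {a w} → a < suc v → Dec (a ≡ v) → Arc a w → 0 < status w
      seen′ a< (yes refl) (q , ≤q , q< , refl) = seenNow s q ≤q q<
      seen′ a< (no a≢v)   arc                  = seen s (≤∧≢⇒< (≤-pred a<) a≢v) arc

    Base : ℕ → Memory → Set
    Base v μ = Inputs (μ 0) (μ 1) (μ 2) × μ 3 0 ≡ v × μ 8 0 ≡ 0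

    φ : Memory → ℕ
    φ μ = Φ (μ 7)

    suc≡ : ∀ {x v} → x ≡ v → x + 1 ≡ suc v
    suc≡ {v = v} eq = trans (cong (_+ 1) eq) (+-comm v 1)

    end≡ : ∀ {x₀ x₁ x₂ x v} → Inputs x₀ x₁ x₂ → x ≡ v → x₁ (x + 1) ≡ off (suc v)
    end≡ inp eq = trans (off≡ inp _) (cong off (suc≡ eq))

    target≡ : ∀ {x₀ x₁ x₂ x p} → Inputs x₀ x₁ x₂ → x ≡ p → x₂ x ≡ adj p
    target≡ inp eq = trans (adj≡ inp _) (cong adj eq)

    test≡ : ∀ {x₀ x₁ x₂ mark x y v q} → Inputs x₀ x₁ x₂ → x ≡ v → y ≡ q →
      x + 1 ∸ mark (x₂ y) ≡ suc v ∸ mark (adj q)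
    test≡ {mark = mark} inp x≡v y≡q = cong₂ _∸_ (suc≡ x≡v) (cong mark (target≡ inp y≡q))

    infix 4 _≤W∶_
    _≤W∶_ : ∀ {x y} → x ≡ y → y ≤ W → x ≤ W
    eq ≤W∶ le = ≤-trans (≤-reflexive eq) le

    -- For loop bodies without inner loops: the time is a closed numeral, compared with 100 by
    -- computation, and the step from `K * p` to `K * suc p` pays for it.
    iteration : ∀ {P μ ν t} e (A : Memory → Set) p → W ⊢⟨ P , μ ⟩⇓ ν ∣ t →
      {_ : T (1 + cost e + t ≤ᵇ 100)} → A ν → φ ν ≤ φ μ →
      Runs W P μ λ ν t → A ν × 1 + cost e + t + φ ν + K * p ≤ φ μ + K * suc p
    iteration {μ = μ} {ν} {t} e A p run {cheap} Aν φ≤ = ν , t , run , Aν , (begin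
      1 + cost e + t + φ ν + K * p ≤⟨ +-monoˡ-≤ (K * p) (+-mono-≤ (≤-trans (≤ᵇ⇒≤ _ 100 cheap) 100≤K) φ≤) ⟩
      K + φ μ + K * p              ≡⟨ arith K (φ μ) p ⟩
      φ μ + K * suc p              ∎)
      where
      open ≤-Reasoning
      arith : ∀ k f p → k + f + k * p ≡ f + k * suc p
      arith = solve-∀

    module _ {v} (v<n : v < n) where

      MarkInv : ℕ → Memory → Set
      MarkInv p μ = Base v μ × μ 4 0 ≡ p × off v ≤ p × Marked v p (μ 6) × Status v (off v) (μ 7)

      markBody-Runs : ∀ {p μ} → p < off (suc v) → MarkInv p μ →
        Runs W markBody μ λ ν t → MarkInv (suc p) ν ×
          1 + cost (1 [ $v ⊕ lit 1 ] ⊖ $p) + t + φ ν + K * p ≤ φ μ + K * suc p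
      markBody-Runs {p} {μ} p< ((inp , ru , rc) , ri , ≤p , m , st) =
        iteration (1 [ $v ⊕ lit 1 ] ⊖ $p) (MarkInv (suc p)) p
          (seq (assign (target≡ inp ri ≤W∶ ≤-trans (<⇒≤ (target< v<n p<)) n≤W) (suc≡ ru ≤W∶ ≤-trans v<n n≤W))
               (assign z≤n (suc≡ ri ≤W∶ next≤W v<n p<)))
          ((inp , ru , rc) , suc≡ ri , m≤n⇒m≤1+n ≤p ,
           subst₂ (λ a x → Marked v (suc p) (μ 6 [ a ]:= x)) (sym (target≡ inp ri)) (sym (suc≡ ru))
             (Marked-step ≤p p< m) , st)
          ≤-refl

      markLoop-Runs : ∀ {μ} → MarkInv (off v) μ →
        Runs W markLoop μ λ ν t → MarkInv (off (suc v)) ν ×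
          t + φ ν + K * off v ≤ 9 + φ μ + K * off (suc v)
      markLoop-Runs = while-Runs MarkInv φ (K *_) (off (suc v))
        (λ { ((inp , ru , _) , ri , _) → cong₂ _∸_ (end≡ inp ru) ri })
        markBody-Runs (off-step v<n)

      module _ {p} (≤p : off v ≤ p) (p< : p < off (suc v)) where
        private a = adj p

        a<n : a < n
        a<n = target< v<n p<

        v→a : Arc v a
        v→a = p , ≤p , p< , refl

        CheckInv : ℕ → Memory → Set
        CheckInv q μ = Base v μ × μ 4 0 ≡ p × μ 5 0 ≡ q × off a ≤ q ×
          Marked v (off (suc v)) (μ 6) × Check v p a q (μ 7)

        checkBody-Runs : ∀ {q μ} → q < off (suc a) → CheckInv q μ →
          Runs W checkBody μ λ ν t → CheckInv (suc q) ν ×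
            1 + cost (1 [ 2 [ $p ] ⊕ lit 1 ] ⊖ $q) + t + φ ν + K * q ≤ φ μ + K * suc q
        checkBody-Runs {q} {μ} q< ((inp , ru , rc) , ri , rj , ≤q , m , c) with suc v ≤? μ 6 (adj q)
        ... | yes marked = iteration (1 [ 2 [ $p ] ⊕ lit 1 ] ⊖ $q) (CheckInv (suc q)) q
          (seq (cond-false (trans (test≡ {mark = μ 6} inp ru rj) (m≤n⇒m∸n≡0 marked)) skip)
               (assign z≤n (suc≡ rj ≤W∶ next≤W a<n q<)))
          ((inp , ru , rc) , ri , suc≡ rj , m≤n⇒m≤1+n ≤q , m , Check-good (sound m _ marked) c)
          ≤-refl
        ... | no unmarked = iteration (1 [ 2 [ $p ] ⊕ lit 1 ] ⊖ $q) (CheckInv (suc q)) q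
          (seq (cond-true (λ z → unmarked (m∸n≡0⇒m≤n (trans (sym (test≡ {mark = μ 6} inp ru rj)) z)))
                 (assign (target≡ inp ri ≤W∶ ≤-trans (<⇒≤ a<n) n≤W) 2≤W))
               (assign z≤n (suc≡ rj ≤W∶ next≤W a<n q<)))
          ((inp , ru , rc) , ri , suc≡ rj , m≤n⇒m≤1+n ≤q , m ,
           subst (λ x → Check v p a (suc q) (μ 7 [ x ]:= 2)) (sym (target≡ inp ri)) (Check-bad branch c))
          (Φ-set (μ 7) (μ 2 (μ 4 0)) 1)
          where
          branch : Branch a
          -- Both are neighbours of `a`. They are distinct and non-adjacent, because `v` and all its
          -- neighbours are marked while the vertex at `q` is not.
          branch = v , adj q , Arc-sym v<n v→a , (q , ≤q , q< , refl) ,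
            (λ v≡ → unmarked (subst (λ x → v < μ 6 x) v≡ (self m))) ,
            λ { (r , ≤r , r< , eq) → unmarked (subst (λ x → v < μ 6 x) eq (complete m r ≤r r<)) }

        checkLoop-Runs : ∀ {μ} → CheckInv (off a) μ →
          Runs W checkLoop μ λ ν t → CheckInv (off (suc a)) ν ×
            t + φ ν + K * off a ≤ 10 + φ μ + K * off (suc a)
        checkLoop-Runs = while-Runs CheckInv φ (K *_) (off (suc a))
          (λ { ((inp , _) , ri , rj , _) → cong₂ _∸_ (end≡ inp (target≡ inp ri)) rj })
          checkBody-Runs (off-step a<n)

      VisitInv : ℕ → Memory → Set
      VisitInv p μ = Base v μ × μ 4 0 ≡ p × off v ≤ p ×
        Marked v (off (suc v)) (μ 6) × Status v p (μ 7)

      visit-Runs : ∀ {p μ} → p < off (suc v) → VisitInv p μ →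
        Runs W visit μ λ ν t → (Base v ν × ν 4 0 ≡ p × Marked v (off (suc v)) (ν 6) × Status v (suc p) (ν 7))
          × t + φ ν ≤ 26 + φ μ
      visit-Runs {p} {μ} p< ((inp , ru , rc) , ri , ≤p , m , st) with μ 7 (μ 2 (μ 4 0)) ≟ 0
      ... | no seen = μ , _ , cond-true seen skip ,
        ((inp , ru , rc) , ri , m ,
          Status-skip (n≢0⇒n>0 (subst (λ x → μ 7 x ≢ 0) (target≡ inp ri) seen)) st) ,
        +-monoˡ-≤ (φ μ) evident
      ... | yes unseen with checkLoop-Runs ≤p p<
            ((inp , ru , rc) , ri , trans (off≡ inp _) (cong off (target≡ inp ri)) , ≤-refl , m ,
             subst (λ x → Check v p (adj p) (off (adj p)) (μ 7 [ x ]:= 1)) (sym (target≡ inp ri))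
               (Check-start ≤p p< st))
      ...   | ν , t , run , (base , ri′ , _ , _ , m′ , c) , t≤ = ν , _ ,
        cond-false unseen
          (seq (assign (target≡ inp ri ≤W∶ ≤-trans (<⇒≤ (a<n ≤p p<)) n≤W) (<⇒≤ 2≤W))
          (seq (assign z≤n (trans (off≡ inp _) (cong off (target≡ inp ri)) ≤W∶
                             ≤-trans (off≤M (<⇒≤ (a<n ≤p p<))) M≤W)) run)) ,
        (base , ri′ , m′ , Check-end (Arc-sym v<n (v→a ≤p p<)) c) ,
        -- 16 is the time spent before the inner loop and 10 that of its last test; together they
        -- give the 26 of the statement.
        bound {c = 16} {g = 10} {t = t} {x = φ ν} (off-suc (a<n ≤p p<)) t≤
          (subst (λ x → Φ (μ 7 [ x ]:= 1) + K * suc (deg (adj p)) ≤ Φ (μ 7)) (sym (target≡ inp ri))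
            (Φ-release (μ 7) 0 (a<n ≤p p<) (subst (λ x → μ 7 x ≡ 0) (target≡ inp ri) unseen)))
        where
        bound : ∀ {c g t o o′ d x y z} → o′ ≡ o + d → t + x + K * o ≤ g + y + K * o′ →
          y + K * suc d ≤ z → c + t + x ≤ c + g + z
        bound {c} {g} {t} {o} {d = d} {x} {y} {z} refl h₁ h₂ = +-cancelʳ-≤ (K * o + y) _ _ (begin
          c + t + x + (K * o + y)               ≡⟨ e₁ c t x (K * o) y ⟩
          c + y + (t + x + K * o)               ≤⟨ +-monoʳ-≤ (c + y) h₁ ⟩
          -- The released credit `K * suc d` exceeds the need `K * d` of the loop by this `K`.
          c + y + (g + y + K * (o + d))         ≤⟨ m≤m+n _ K ⟩
          c + y + (g + y + K * (o + d)) + K     ≡⟨ e₂ K c g y o d ⟩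
          c + g + K * o + y + (y + K * suc d)   ≤⟨ +-monoʳ-≤ (c + g + K * o + y) h₂ ⟩
          c + g + K * o + y + z                 ≡⟨ e₃ (c + g) (K * o) y z ⟩
          c + g + z + (K * o + y)               ∎)
          where
          open ≤-Reasoning
          e₁ : ∀ c t x o y → c + t + x + (o + y) ≡ c + y + (t + x + o)
          e₁ = solve-∀
          e₂ : ∀ k c g y o d → c + y + (g + y + k * (o + d)) + k ≡ c + g + k * o + y + (y + k * suc d)
          e₂ = solve-∀
          e₃ : ∀ c o y z → c + o + y + z ≡ c + z + (o + y)
          e₃ = solve-∀

      visitBody-Runs : ∀ {p μ} → p < off (suc v) → VisitInv p μ →
        Runs W visitBody μ λ ν t → VisitInv (suc p) ν ×
          1 + cost (1 [ $v ⊕ lit 1 ] ⊖ $p) + t + φ ν + K * p ≤ φ μ + K * suc p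
      visitBody-Runs {p} p< inv@(_ , _ , ≤p , _) with visit-Runs p< inv
      ... | ν , t , run , (base , ri , m , st) , t≤ = _ , _ ,
        seq run (assign z≤n (suc≡ ri ≤W∶ next≤W v<n p<)) ,
        (base , suc≡ ri , m≤n⇒m≤1+n ≤p , m , st) ,
        bound 9 {6} {26} {t} {φ ν} t≤ (≤-trans evident 100≤K)
        where
        bound : ∀ c {d g t x y} → t + x ≤ g + y → c + d + g ≤ K → c + (t + d) + x + K * p ≤ y + K * suc p
        bound c {d} {g} {t} {x} {y} h₁ h₂ = begin
          c + (t + d) + x + K * p   ≡⟨ e₁ c d t x (K * p) ⟩
          c + d + (t + x) + K * p   ≤⟨ +-monoˡ-≤ (K * p) (+-monoʳ-≤ (c + d) h₁) ⟩
          c + d + (g + y) + K * p   ≡⟨ e₂ (c + d) g y (K * p) ⟩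
          c + d + g + (y + K * p)   ≤⟨ +-monoˡ-≤ (y + K * p) h₂ ⟩
          K + (y + K * p)           ≡⟨ e₃ K y p ⟩
          y + K * suc p             ∎
          where
          open ≤-Reasoning
          e₁ : ∀ c d t x p → c + (t + d) + x + p ≡ c + d + (t + x) + p
          e₁ = solve-∀
          e₂ : ∀ c g y p → c + (g + y) + p ≡ c + g + (y + p)
          e₂ = solve-∀
          e₃ : ∀ k y p → k + (y + k * p) ≡ y + k * suc p
          e₃ = solve-∀

      visitLoop-Runs : ∀ {μ} → VisitInv (off v) μ →
        Runs W visitLoop μ λ ν t → VisitInv (off (suc v)) ν ×
          t + φ ν + K * off v ≤ 9 + φ μ + K * off (suc v)
      visitLoop-Runs = while-Runs VisitInv φ (K *_) (off (suc v))
        (λ { ((inp , ru , _) , ri , _) → cong₂ _∸_ (end≡ inp ru) ri })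
        visitBody-Runs (off-step v<n)

    RoundInv : ℕ → Memory → Set
    RoundInv v μ = Base v μ × (∀ w → μ 6 w ≤ v) × Status v (off v) (μ 7)

    -- Two traversals of each list, and a constant for each round.
    weight : ℕ → ℕ
    weight v = K * off v + K * off v + K * v

    round-Runs : ∀ {v μ} → v < n → RoundInv v μ →
      Runs W round μ λ ν t → RoundInv (suc v) ν ×
        1 + cost (0 [ lit 0 ] ⊖ $v) + t + φ ν + weight v ≤ φ μ + weight (suc v)
    round-Runs {v} {μ} v<n ((inp , ru , rc) , old , st)
      with markLoop-Runs v<n
        ((inp , ru , rc) , trans (off≡ inp _) (cong off ru) , ≤-refl ,
         subst₂ (λ a x → Marked v (off v) (μ 6 [ a ]:= x)) (sym ru) (sym (suc≡ ru)) (Marked-start old) , st)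
    ... | ν₁ , t₁ , run₁ , ((inp₁ , ru₁ , rc₁) , _ , _ , m₁ , st₁) , t₁≤
      with visitLoop-Runs v<n
        ((inp₁ , ru₁ , rc₁) , trans (off≡ inp₁ _) (cong off ru₁) , ≤-refl , m₁ , st₁)
    ... | ν₂ , t₂ , run₂ , ((inp₂ , ru₂ , rc₂) , _ , _ , m₂ , st₂) , t₂≤ = _ , _ ,
      seq (assign (ru ≤W∶ ≤-trans (<⇒≤ v<n) n≤W) (suc≡ ru ≤W∶ ≤-trans v<n n≤W))
      (seq (assign z≤n (start≤W inp ru))
      (seq run₁ (seq (assign z≤n (start≤W inp₁ ru₁))
      (seq run₂ (assign z≤n (suc≡ ru₂ ≤W∶ ≤-trans v<n n≤W)))))) ,
      ((inp₂ , suc≡ ru₂ , rc₂) , bounded m₂ , Status-next st₂) ,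
      -- The costs of the outer test, of the four assignments in order, and of the last tests of the
      -- two inner loops.
      bound 6 7 5 5 6 {9} {9} {t₁} {t₂} {φ μ} {φ ν₁} {φ ν₂} {K * off v} {K * off (suc v)} t₁≤ t₂≤ (≤-trans evident 100≤K)
      where
      start≤W : ∀ {x₀ x₁ x₂ x} → Inputs x₀ x₁ x₂ → x ≡ v → x₁ x ≤ W
      start≤W inp eq = trans (off≡ inp _) (cong off eq) ≤W∶ ≤-trans (off≤M (<⇒≤ v<n)) M≤W

      bound : ∀ c c₁ c₂ c₃ c₄ {g₁ g₂ t₁ t₂ x y z o o′ v} →
        t₁ + y + o ≤ g₁ + x + o′ → t₂ + z + o ≤ g₂ + y + o′ →
        c + c₁ + c₂ + c₃ + c₄ + g₁ + g₂ ≤ K →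
        c + (c₁ + (c₂ + (t₁ + (c₃ + (t₂ + c₄))))) + z + (o + o + K * v) ≤ x + (o′ + o′ + K * suc v)
      bound c c₁ c₂ c₃ c₄ {g₁} {g₂} {t₁} {t₂} {x} {y} {z} {o} {o′} {v} h₁ h₂ h₃ =
        +-cancelʳ-≤ y _ _ (begin
          c + (c₁ + (c₂ + (t₁ + (c₃ + (t₂ + c₄))))) + z + (o + o + K * v) + y
            ≡⟨ e₁ K c c₁ c₂ c₃ c₄ t₁ t₂ y z o v ⟩
          c + c₁ + c₂ + c₃ + c₄ + (t₁ + y + o) + (t₂ + z + o) + K * v
            ≤⟨ +-monoˡ-≤ (K * v) (+-mono-≤ (+-monoʳ-≤ (c + c₁ + c₂ + c₃ + c₄) h₁) h₂) ⟩
          c + c₁ + c₂ + c₃ + c₄ + (g₁ + x + o′) + (g₂ + y + o′) + K * v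
            ≡⟨ e₂ K (c + c₁ + c₂ + c₃ + c₄) g₁ g₂ x y o′ v ⟩
          c + c₁ + c₂ + c₃ + c₄ + g₁ + g₂ + (x + (o′ + o′ + K * v) + y)
            ≤⟨ +-monoˡ-≤ (x + (o′ + o′ + K * v) + y) h₃ ⟩
          K + (x + (o′ + o′ + K * v) + y)
            ≡⟨ e₃ K x y o′ v ⟩
          x + (o′ + o′ + K * suc v) + y ∎)
        where
        open ≤-Reasoning
        e₁ : ∀ K c c₁ c₂ c₃ c₄ t₁ t₂ y z o v →
          c + (c₁ + (c₂ + (t₁ + (c₃ + (t₂ + c₄))))) + z + (o + o + K * v) + y ≡
          c + c₁ + c₂ + c₃ + c₄ + (t₁ + y + o) + (t₂ + z + o) + K * v
        e₁ = solve-∀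
        e₂ : ∀ K c g₁ g₂ x y o v →
          c + (g₁ + x + o) + (g₂ + y + o) + K * v ≡ c + g₁ + g₂ + (x + (o + o + K * v) + y)
        e₂ = solve-∀
        e₃ : ∀ K x y o v → K + (x + (o + o + K * v) + y) ≡ x + (o + o + K * suc v) + y
        e₃ = solve-∀

    rounds-Runs : ∀ {μ} → RoundInv 0 μ →
      Runs W rounds μ λ ν t → RoundInv n ν × t + φ ν + weight 0 ≤ 6 + φ μ + weight n
    rounds-Runs = while-Runs RoundInv φ weight n
      (λ { ((inp , ru , _) , _) → cong₂ _∸_ (order≡ inp) ru }) round-Runs z≤n

    CountInv : (ℕ → ℕ) → ℕ → Memory → Set
    CountInv s v μ = Inputs (μ 0) (μ 1) (μ 2) × μ 3 0 ≡ v × (∀ w → μ 7 w ≡ s w) × μ 8 0 ≡ tally s v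

    countBody-Runs : ∀ {s v μ} → v < n → CountInv s v μ →
      Runs W countBody μ λ ν t → CountInv s (suc v) ν ×
        1 + cost (0 [ lit 0 ] ⊖ $v) + t + φ ν + K * v ≤ φ μ + K * suc v
    countBody-Runs {s} {v} {μ} v<n (inp , ru , rs , rc) with μ 7 (μ 3 0) ∸ 1 ≟ 0
    ... | yes small = iteration (0 [ lit 0 ] ⊖ $v) (CountInv s (suc v)) v
      (seq (cond-false small (assign z≤n (sum≡ ≤W∶ ≤-trans (≤-trans (tally≤ s (suc v)) v<n) n≤W)))
           (assign z≤n (suc≡ ru ≤W∶ ≤-trans v<n n≤W)))
      (inp , suc≡ ru , rs , sum≡)
      ≤-refl
      where
      one : ∀ x → x ∸ 1 ≡ 0 → unbranched x ≡ 1
      one zero          _ = refl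
      one (suc zero)    _ = refl
      sum≡ : μ 8 0 + 1 ≡ tally s (suc v)
      sum≡ = cong₂ _+_ rc (sym (one (s v) (trans (cong (_∸ 1) (trans (sym (rs v)) (cong (μ 7) (sym ru)))) small)))
    ... | no big = iteration (0 [ lit 0 ] ⊖ $v) (CountInv s (suc v)) v
      (seq (cond-true big skip) (assign z≤n (suc≡ ru ≤W∶ ≤-trans v<n n≤W)))
      (inp , suc≡ ru , rs ,
       trans rc (trans (sym (+-identityʳ _)) (cong (tally s v +_) (sym (none (s v)
         λ z → big (trans (cong (_∸ 1) (trans (cong (μ 7) ru) (rs v))) z))))))
      ≤-refl
      where
      none : ∀ x → x ∸ 1 ≢ 0 → unbranched x ≡ 0
      none zero          nz = contradiction refl nz
      none (suc zero)    nz = contradiction refl nz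
      none (suc (suc _)) _  = refl

    countLoop-Runs : ∀ {s μ} → CountInv s 0 μ →
      Runs W countLoop μ λ ν t → CountInv s n ν × t + φ ν + K * 0 ≤ 6 + φ μ + K * n
    countLoop-Runs {s} = while-Runs (CountInv s) φ (K *_) n
      (λ { (inp , ru , _) → cong₂ _∸_ (order≡ inp) ru }) countBody-Runs z≤n

    Verdict : (ℕ → ℕ) → Memory → Set
    Verdict s ν = (tally s n ≤ k × ν 0 0 ≡ 1) ⊎ (¬ tally s n ≤ k × ν 0 0 ≡ 0)

    decide-Runs : ∀ {s μ} → CountInv s n μ →
      Runs W decide μ λ ν t → Verdict s ν × t ≤ 20
    decide-Runs {s} {μ} (inp , _ , _ , rc) with tally s n ≤? k
    ... | yes ≤k = _ , _ ,
      cond-false (trans (cong₂ _∸_ rc (bound≡ inp)) (m≤n⇒m∸n≡0 ≤k)) (assign z≤n (<⇒≤ 2≤W)) ,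
      inj₁ (≤k , refl) , evident
    ... | no ≰k = _ , _ ,
      cond-true (λ z → ≰k (m∸n≡0⇒m≤n (trans (sym (cong₂ _∸_ rc (bound≡ inp))) z))) (assign z≤n z≤n) ,
      inj₂ (≰k , refl) , evident

    record Outcome (s : ℕ → ℕ) : Set where
      field
        branch    : ∀ v → 2 ≤ s v → Branch v
        dominated : ∀ v → s v ≡ 1 → Dominated v
        reached   : ∀ {a v} → a < n → Arc a v → 0 < s v

    -- The factor 3 bounds the sum of the initial credit `K * (off n + n)`, the weight
    -- `K * (2 * off n + n)` of the rounds and the `K * n` of the count.
    Final : Memory → ℕ → Set
    Final ν t = Σ[ s ∈ (ℕ → ℕ) ] (Outcome s × Verdict s ν × t ≤ 40 + 3 * (K * (off n + n)))

    program-Runs : ∀ {μ} → Inputs (μ 0) (μ 1) (μ 2) → (∀ a p → μ (3 + a) p ≡ 0) →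
      Runs W program μ Final
    program-Runs {μ} inp zeros
      with rounds-Runs ((inp , zeros 0 0 , zeros 5 0) , (λ w → ≤-reflexive (zeros 3 w)) , start)
      where
      none : ∀ {P : ℕ → Set} {c} → ∀ w → suc c ≤ μ 7 w → P w
      none w c< = contradiction (≤-trans c< (≤-reflexive (zeros 4 w))) λ ()
      start : Status 0 (off 0) (μ 7)
      start = record
        { bad     = none {Branch}
        ; good    = λ w eq → none {Dominated} w (≤-reflexive (sym eq))
        ; seen    = λ ()
        ; seenNow = λ q ≤q q< → contradiction q< (≤⇒≯ ≤q)
        }
    ... | ν₁ , t₁ , run₁ , ((inp₁ , _ , rc₁) , _ , st₁) , t₁≤
      with countLoop-Runs {s = ν₁ 7} {μ = ν₁ [ 3 , 0 ↦ 0 ]} (inp₁ , refl , (λ _ → refl) , rc₁)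
    ... | ν₂ , t₂ , run₂ , inv₂ , t₂≤ with decide-Runs inv₂
    ... | ν₃ , t₃ , run₃ , answer , t₃≤ = ν₃ , _ ,
      seq run₁ (seq (assign z≤n z≤n) (seq run₂ run₃)) , ν₁ 7 ,
      record { branch = bad st₁ ; dominated = good st₁ ; reached = seen st₁ } , answer ,
      bound (Φ-unseen (μ 7) (zeros 4)) t₁≤ t₂≤ t₃≤
      where
      bound : ∀ {x y z t₁ t₂ t₃ w} → x ≡ K * (off n + n) →
        t₁ + y + w ≤ 6 + x + weight n → t₂ + z + K * 0 ≤ 6 + y + K * n → t₃ ≤ 20 →
        t₁ + (3 + (t₂ + t₃)) ≤ 40 + 3 * (K * (off n + n))
      bound {y = y} {z} {t₁} {t₂} {t₃} {w} refl h₁ h₂ h₃ = +-cancelʳ-≤ y _ _ (begin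
        t₁ + (3 + (t₂ + t₃)) + y
          ≤⟨ m≤m+n _ (w + (z + K * 0)) ⟩
        t₁ + (3 + (t₂ + t₃)) + y + (w + (z + K * 0))
          ≡⟨ e₁ t₁ t₂ t₃ y w z (K * 0) ⟩
        3 + (t₁ + y + w) + (t₂ + z + K * 0) + t₃
          ≤⟨ +-mono-≤ (+-mono-≤ (+-monoʳ-≤ 3 h₁) h₂) h₃ ⟩
        3 + (6 + K * (off n + n) + weight n) + (6 + y + K * n) + 20
          ≡⟨ e₂ K (off n) n y ⟩
        35 + 3 * (K * (off n + n)) + y
          ≤⟨ +-monoˡ-≤ y (+-monoˡ-≤ (3 * (K * (off n + n))) (evident {35} {40})) ⟩
        40 + 3 * (K * (off n + n)) + y ∎)
        where
        open ≤-Reasoning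
        e₁ : ∀ t₁ t₂ t₃ y w z o → t₁ + (3 + (t₂ + t₃)) + y + (w + (z + o)) ≡ 3 + (t₁ + y + w) + (t₂ + z + o) + t₃
        e₁ = solve-∀
        e₂ : ∀ K o n y → 3 + (6 + K * (o + n) + (K * o + K * o + K * n)) + (6 + y + K * n) + 20 ≡
          35 + 3 * (K * (o + n)) + y
        e₂ = solve-∀

-- From the final statuses to strong geodetic sets

module Verification (G : Graph) (L : AdjacencyLists G) (k : ℕ) (1≤k : 1 ≤ k)
  (connected : Graph.Connected G) (block : Graph.IsBlockGraph G)
  {c K : ℕ} (100≤K : 100 ≤ K) (large : 40 + 6 * K ≤ c) where
  open Graph G renaming (sym to ~-sym)
  open Walks G
  open BlockGraph G block
  open Layout G L k

  N : ℕ
  N = order + size + k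

  1≤order : 1 ≤ order
  1≤order = >-nonZero⁻¹ order {{nonempty}}

  2≤c : 2 ≤ c
  2≤c = ≤-trans (≤-trans evident (m≤m+n 40 (6 * K))) large

  2≤N : 2 ≤ N
  2≤N = +-mono-≤ (≤-trans 1≤order (m≤m+n order size)) 1≤k

  NN≤Nᶜ : N * N ≤ N ^ c
  NN≤Nᶜ = ≤-trans (≤-reflexive (cong (N *_) (sym (*-identityʳ N))))
    (^-monoʳ-≤ N {{>-nonZero (<⇒≤ 2≤N)}} 2≤c)

  -- Positions in the lists run up to `2 * size`, so the word bound must cover twice `N`; `N * N`
  -- does, as `N` is at least 2.
  2N≤Nᶜ : N + N ≤ N ^ c
  2N≤Nᶜ = ≤-trans (≤-reflexive (cong (N +_) (sym (+-identityʳ N)))) (≤-trans (*-monoˡ-≤ N 2≤N) NN≤Nᶜ)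

  N≤Nᶜ : N ≤ N ^ c
  N≤Nᶜ = ≤-trans (m≤m+n N N) 2N≤Nᶜ

  size≤N : size ≤ N
  size≤N = ≤-trans (m≤n+m size order) (m≤m+n (order + size) k)

  open Algorithm {W = N ^ c} {n = order} {k = k} {off = off} {adj = adj} {deg = deg}
    (≤-trans (≤-trans (m≤m+n order size) (m≤m+n (order + size) k)) N≤Nᶜ)
    (≤-trans off-order≤ (≤-trans (+-mono-≤ size≤N size≤N) 2N≤Nᶜ))
    (≤-trans 2≤N N≤Nᶜ)
    off-zero off-suc adj< K 100≤K

  Arc-sym : ∀ {v w} → v < order → Arc v w → Arc w v
  Arc-sym {v} {w} v< arc
    with arc⁻ {fromℕ< v<} (subst (λ x → Arc x w) (sym (Fin.toℕ-fromℕ< v<)) arc)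
  ... | x , v~x , refl = subst (Arc (toℕ x)) (Fin.toℕ-fromℕ< v<) (arc⁺ (~-sym v~x))

  open Correctness Arc-sym

  module _ {s : ℕ → ℕ} (outcome : Outcome s) where
    open Outcome outcome

    unbranched? : Decidable (λ (v : Vertex) → s (toℕ v) ≤ 1)
    unbranched? v = s (toℕ v) ≤? 1

    S : Subset order
    S = ⟪ unbranched? ⟫

    ∉S⇒Branching : ∀ {v} → v ∉ S → Branching v
    ∉S⇒Branching {v} v∉S with branch (toℕ v) (≰⇒> (v∉S ∘ ∈⟪⟫⁺ unbranched?))
    ... | _ , _ , v→a , v→b , a≢b , a↛b with arc⁻ v→a | arc⁻ v→b
    ...   | a , v~a , refl | b , v~b , refl = a , b , v~a , v~b , a≢b ∘ cong toℕ , a↛b ∘ arc⁺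

    Dominated⇒Simplicial : ∀ {v} → Dominated (toℕ v) → Simplicial v
    Dominated⇒Simplicial {v} (_ , v→u , dom) with arc⁻ v→u
    ... | u , v~u , refl = dominated⇒Simplicial v~u λ {w} v~w w≢u → adjacent w≢u (dom (toℕ w) (arc⁺ v~w))
      where
      adjacent : ∀ {w} → w ≢ u → toℕ w ≡ toℕ u ⊎ Arc (toℕ u) (toℕ w) → u ~ w
      adjacent w≢u (inj₁ w≡u) = contradiction (Fin.toℕ-injective w≡u) w≢u
      adjacent _   (inj₂ u→w) with arc⁻ u→w
      ... | x , u~x , w≡x = subst (u ~_) (Fin.toℕ-injective (sym w≡x)) u~x

    -- A neighbour would list `v`, which would then have been met; so `v` is isolated and the
    -- condition is vacuous.
    unreached⇒Simplicial : ∀ {v} → s (toℕ v) ≡ 0 → Simplicial v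
    unreached⇒Simplicial unreached v~a _ _ =
      contradiction unreached (≢-sym (<⇒≢ (reached (Fin.toℕ<n _) (arc⁺ (~-sym v~a)))))

    ∈S⇒Simplicial : ∀ {v} → v ∈ S → Simplicial v
    ∈S⇒Simplicial {v} v∈S = by-status (s (toℕ v)) refl (∈⟪⟫⁻ unbranched? v∈S)
      where
      by-status : ∀ x → s (toℕ v) ≡ x → x ≤ 1 → Simplicial v
      by-status zero          eq _ = unreached⇒Simplicial eq
      by-status (suc zero)    eq _ = Dominated⇒Simplicial (dominated (toℕ v) eq)
      by-status (suc (suc _)) _  (s≤s ())

    tally≤⇒StrongGeodetic : tally s order ≤ k → StrongGeodetic k
    tally≤⇒StrongGeodetic ≤k =
      S , isStrongGeodetic ∉S⇒Branching connected , ≤-trans (≤-reflexive (∣⟪≤1⟫∣ order s)) ≤k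

    StrongGeodetic⇒tally≤ : StrongGeodetic k → tally s order ≤ k
    StrongGeodetic⇒tally≤ (R , geodetic , ≤k) = ≤-trans (≤-reflexive (sym (∣⟪≤1⟫∣ order s)))
      (≤-trans (p⊆q⇒∣p∣≤∣q∣ λ v∈S → Simplicial⇒∈ (∈S⇒Simplicial v∈S) geodetic) ≤k)

    answers : ∀ {ν} → Verdict s ν → Answers ν (StrongGeodetic k)
    answers (inj₁ (≤k , out)) = inj₁ (tally≤⇒StrongGeodetic ≤k , out)
    answers (inj₂ (≰k , out)) = inj₂ (≰k ∘ StrongGeodetic⇒tally≤ , out)

  -- A graph has at least one vertex, which absorbs the constant 40; the lists have at most
  -- `2 * size` entries, which turns `3 * K` into `6 * K`.
  linear : 40 + 3 * (K * (off order + order)) ≤ c * (order + size)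
  linear = begin
    40 + 3 * (K * (off order + order))
      ≤⟨ +-mono-≤ (*-monoʳ-≤ 40 (≤-trans 1≤order (m≤m+n order size)))
                  (*-monoʳ-≤ 3 (*-monoʳ-≤ K (+-mono-≤ off-order≤ (m≤m+n order order)))) ⟩
    40 * (order + size) + 3 * (K * (size + size + (order + order)))
      ≡⟨ arith K order size ⟩
    (40 + 6 * K) * (order + size)
      ≤⟨ *-monoˡ-≤ (order + size) large ⟩
    c * (order + size) ∎
    where
    open ≤-Reasoning
    arith : ∀ K n m → 40 * (n + m) + 3 * (K * (m + m + (n + n))) ≡ (40 + 6 * K) * (n + m)
    arith = solve-∀

  solves : ∃[ μ ] ∃[ t ] ((N ^ c ⊢⟨ program , input G L k ⟩⇓ μ ∣ t) ×
    t ≤ c * (order + size) × Answers μ (StrongGeodetic k))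
  solves = conclude (program-Runs inputs λ _ _ → refl)
    where
    inputs : Inputs (input G L k 0) (input G L k 1) (input G L k 2)
    inputs = record { order≡ = refl ; bound≡ = refl ; off≡ = λ _ → refl ; adj≡ = λ _ → refl }

    conclude : Runs (N ^ c) program (input G L k) Final → _
    conclude (ν , t , run , _ , outcome , verdict , t≤) =
      ν , t , run , ≤-trans t≤ linear , answers outcome {ν} verdict

-- 640 = 40 + 6 K for K = 100.
linear-time : ∀ {c} → 640 ≤ c →
  SolvesInLinearTime (λ G → Graph.Connected G × Graph.IsBlockGraph G) program c
linear-time 640≤c G L k (connected , block) 1≤k =
  Verification.solves G L k 1≤k connected block {K = 100} ≤-refl 640≤c

corollary10 : Σ[ P ∈ Program ] Σ[ c ∈ ℕ ] SolvesInLinearTime (λ G → Graph.Connected G × Graph.IsBlockGraph G) P c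
corollary10 = program , 640 , linear-time ≤-refl
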